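{- Let $p$ be a prime and $q=p^s$ for $s$ a positive integer. If $f(x)=a_px^p-a_1x-a_0\in \mathbb{F}_q[x]$ with $a_p a_1\neq 0$, then $f^2(x)$ is reducible over $\mathbb{F}_q$ if $p\geq 3$, and $f^3(x)$ is reducible over $\mathbb{F}_q$ if $p=2$.
   Context: $\mathbb{F}_q$ is the finite field with $q$ elements. For a polynomial $f$, $f^n$ denotes the $n$-fold composition of $f$ with itself (so $f^2=f\circ f$ and $f^3=f\circ f\circ f$). -}

module Defs where

open import Algebra.Apartness.Bundles using (HeytingCommutativeRing; HeytingField)
open import Algebra.Bundles using (CommutativeRing)
open import Data.Fin.Base using (Fin)
open import Data.List.Base using (List; []; _∷_; map)
open import Data.Nat.Base using (ℕ; zero; suc; _<_)
open import Data.Product.Base using (_×_; ∃-syntax)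
open import Function.Bundles using (Inverse)
open import Level using (Level; _⊔_) renaming (suc to lsuc)
open import Relation.Binary.PropositionalEquality.Properties using () renaming (setoid to ≡-setoid)
open import Relation.Nullary.Negation using (¬_)

-- A field with exactly q elements, counted up to _≈_.  The enumeration makes _≈_
-- decidable, so _#_ (difference is invertible) coincides with the negation of _≈_ and
-- the underlying Heyting field is a field in the classical sense.  The zero ring is
-- excluded, because there 0# - 0# is invertible, whence 0# # 0#.
record FiniteField (c ℓ₁ ℓ₂ : Level) (q : ℕ) : Set (lsuc (c ⊔ ℓ₁ ⊔ ℓ₂)) where
  field
    heytingField : HeytingField c ℓ₁ ℓ₂

  open HeytingField heytingField public

  commutativeRing : CommutativeRing c ℓ₁
  commutativeRing = HeytingCommutativeRing.commutativeRing heytingCommutativeRing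

  field
    enumeration : Inverse (CommutativeRing.setoid commutativeRing) (≡-setoid (Fin q))

module Polynomials {c ℓ : Level} (R : CommutativeRing c ℓ) where

  open CommutativeRing R

  infix  4 _≈ₚ_
  infixl 6 _+ₚ_ _-ₚ_
  infixl 7 _*ₚ_ _·ₚ_
  infix  8 -ₚ_
  infixr 9 _∘ₚ_
  infixl 10 _^∘_

  -- a₀ ∷ a₁ ∷ … ∷ aₙ ∷ [] stands for a₀ + a₁ x + … + aₙ xⁿ.  Trailing zeros are
  -- allowed; _≈ₚ_ is the equality of polynomials.
  Poly : Set c
  Poly = List Carrier

  coeff : Poly → ℕ → Carrier
  coeff []      _       = 0#
  coeff (a ∷ _) zero    = a
  coeff (_ ∷ f) (suc n) = coeff f n

  _≈ₚ_ : Poly → Poly → Set ℓ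
  f ≈ₚ g = ∀ n → coeff f n ≈ coeff g n

  constant : Carrier → Poly
  constant a = a ∷ []

  -- monomial a n is a xⁿ.
  monomial : Carrier → ℕ → Poly
  monomial a zero    = constant a
  monomial a (suc n) = 0# ∷ monomial a n

  X : Poly
  X = monomial 1# 1

  _+ₚ_ : Poly → Poly → Poly
  []      +ₚ g       = g
  (a ∷ f) +ₚ []      = a ∷ f
  (a ∷ f) +ₚ (b ∷ g) = (a + b) ∷ (f +ₚ g)

  -ₚ_ : Poly → Poly
  -ₚ_ = map (-_)

  _-ₚ_ : Poly → Poly → Poly
  f -ₚ g = f +ₚ (-ₚ g)

  _·ₚ_ : Carrier → Poly → Poly
  a ·ₚ f = map (a *_) f

  _*ₚ_ : Poly → Poly → Poly
  []      *ₚ g = []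
  (a ∷ f) *ₚ g = (a ·ₚ g) +ₚ (0# ∷ (f *ₚ g))

  -- Horner's scheme: (a + x f)(g) = a + g f(g).
  _∘ₚ_ : Poly → Poly → Poly
  []      ∘ₚ g = []
  (a ∷ f) ∘ₚ g = constant a +ₚ (g *ₚ (f ∘ₚ g))

  _^∘_ : Poly → ℕ → Poly
  f ^∘ zero  = X
  f ^∘ suc n = f ∘ₚ (f ^∘ n)

  HasDegree : Poly → ℕ → Set ℓ
  HasDegree f d = ¬ (coeff f d ≈ 0#) × (∀ n → d < n → coeff f n ≈ 0#)

  PositiveDegree : Poly → Set ℓ
  PositiveDegree f = ∃[ d ] HasDegree f (suc d)

  -- The usual notion when R is a field.
  Reducible : Poly → Set (c ⊔ ℓ)
  Reducible f = ∃[ g ] ∃[ h ] (PositiveDegree g × PositiveDegree h × f ≈ₚ g *ₚ h)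

{-# OPTIONS --safe #-}

-- Write f = L - c with L = a xᵖ - b x additive.  If c = L(r), then f ∘ g = L(g - r) is divisible
-- by g - r for every g.  Otherwise L is not onto 𝔽_q, hence has a kernel element d ≠ 0, and after
-- rescaling by d the iterates x, y = f(x), z = f(y), … satisfy xᵖ = x + b⁻¹y + e, yᵖ = y + b⁻¹z + e, …
-- with e not in the image of ℘(u) = uᵖ - u on 𝔽_q.
--
-- Let P be the iterate in question.  It suffices to find v whose degree n in x is positive and
-- small, with P ∣ vᵖ - v: if vᵖ - v factors into polynomials of degree less than deg P, then the
-- Euclidean algorithm splits P.  For p = 2m + 1 and P = f², vᵖ - v = v (vᵐ - 1) (vᵐ + 1)
-- and v is a combination of x, y, y² and 1; for p = 2 and P = f³, v² - v = v (v - 1) and v is a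
-- combination of x, y, z, yz and 1.  The coefficients of v exist because ℘(𝔽_q) has index p in
-- 𝔽_q, so that 𝔽_q = 𝔽ₚ e + ℘(𝔽_q).
module Submission where

open import Defs
open import Algebra.Bundles using (CommutativeRing; RawRing)
open import Algebra.Solver.Ring.AlmostCommutativeRing using (fromCommutativeRing; _-Raw-AlmostCommutative⟶_)
open import Data.Fin.Base using (Fin; toℕ; fromℕ; inject₁; punchOut) renaming (zero to fzero; suc to fsuc)
open import Data.Fin.Permutation using (Permutation′; permutation)
open import Data.Fin.Properties as Fin using (any?; punchOut-injective; toℕ-fromℕ; toℕ-inject₁; toℕ<n)
open import Data.List.Base using ([]; _∷_; length; foldr)
open import Data.List.Relation.Unary.All using (All; []; _∷_)
open import Data.Maybe.Base as Maybe using (Maybe)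
open import Data.Nat.Base as ℕ using (ℕ; zero; suc; _≤_; _<_; _∸_; _!; s≤s; z≤n)
open import Data.Nat.Combinatorics using (_C_; nCn≡1; nCk≡n!/k![n-k]!; k![n∸k]!∣n!)
open import Data.Nat.Divisibility as ℕ using (divides; m∣m*n; ∣⇒≤)
open import Data.Nat.DivMod using (m/n*n≡m)
open import Data.Nat.Primality using (Prime; euclidsLemma; ¬prime[0]; ¬prime[1]; prime⇒irreducible)
import Data.Nat.Properties as ℕ
open import Data.Product.Base using (_,_; ∃-syntax; proj₁; proj₂) renaming (_×_ to _∧_)
open import Data.Sum.Base using (_⊎_; inj₁; inj₂)
open import Function.Base using (_∘_)
open import Function.Bundles using (Inverse)
open import Function.Definitions using (Injective; StrictlySurjective)
open import Level using (Level; _⊔_)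
open import Relation.Binary.Definitions using (tri<; tri≈; tri>)
open import Relation.Binary.PropositionalEquality as ≡ using (_≡_)
open import Relation.Nullary.Decidable as Dec using (Dec; yes; no; decidable-stable; dec⇒maybe; ¬?; _×-dec_)
open import Relation.Nullary.Negation using (¬_; contradiction)

-- The principle is that of Berlekamp's factorization method: modulo an irreducible `P`, a `v` with
-- `vᵖ = v` would be congruent to a constant of `𝔽ₚ`, which a `v` of positive degree below `deg P`
-- cannot be. For `v = x + u y + w` the coefficient of `y` in `vᵖ - v` gives the condition
-- `b⁻¹ + ℘ u = 0`, which may have no solution. A term `k y²` with `k` in `𝔽ₚ` repairs this: modulo
-- `P` it contributes `2 k e y + k e²`, and a suitable `2 k e` moves `b⁻¹` into `℘(𝔽_q)`. For
-- `p = 2` the factor 2 kills the correction and `y²` is as long as `f²`; indeed `x² + x + 1` over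
-- `𝔽₂` has an irreducible second iterate. One more iterate makes room for `k y z`, which
-- contributes `k e y`; the term `k b⁻¹ z²` that comes with it is linear modulo `P`, because
-- `z² = zᵖ`. Splitting `vᵖ - v` into three factors instead of the `p` factors `v - j` costs degree,
-- but `vᵐ ± 1` has degree at most `2 m deg y`, still below `deg P = (2 m + 1) deg y`.

-- Prime divisors of factorials and binomial coefficients

prime∤! : ∀ {p} → Prime p → ∀ k → k < p → ¬ (p ℕ.∣ k !)
prime∤! p-prime zero    k<p p∣1 = contradiction (∣⇒≤ p∣1) (ℕ.<⇒≱ (ℕ.≤∧≢⇒< k<p (λ { ≡.refl → ¬prime[1] p-prime })))
prime∤! p-prime (suc k) k<p p∣k! with euclidsLemma (suc k) (k !) p-prime p∣k!
... | inj₁ p∣k = ℕ.<⇒≱ k<p (∣⇒≤ p∣k)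
... | inj₂ p∣k! = prime∤! p-prime k (ℕ.<⇒≤ k<p) p∣k!

-- `p` divides `p ! = (p C k) · k ! · (p ∸ k) !`, and both factorials are products of numbers below
-- `p`.
prime∣binomial : ∀ {p k} → Prime p → 0 < k → k < p → p ℕ.∣ p C k
prime∣binomial {zero}        p-prime _ _ = contradiction p-prime ¬prime[0]
prime∣binomial {p@(suc _)} {k} p-prime 0<k k<p
  with euclidsLemma (p C k) (k ! ℕ.* (p ∸ k) !) p-prime (≡.subst (p ℕ.∣_) (≡.sym p!) (m∣m*n _))
  where
  instance _ = ℕ.m*n≢0 (k !) ((p ∸ k) !) {{k ℕ.!≢0}} {{(p ∸ k) ℕ.!≢0}}
  p! : (p C k) ℕ.* (k ! ℕ.* (p ∸ k) !) ≡ p !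
  p! = ≡.trans (≡.cong (λ c → c ℕ.* (k ! ℕ.* (p ∸ k) !)) (nCk≡n!/k![n-k]! (ℕ.<⇒≤ k<p))) (m/n*n≡m (k![n∸k]!∣n! (ℕ.<⇒≤ k<p)))
... | inj₁ p∣C = p∣C
... | inj₂ p∣kk with euclidsLemma (k !) ((p ∸ k) !) p-prime p∣kk
...   | inj₁ p∣k! = contradiction p∣k! (prime∤! p-prime k k<p)
...   | inj₂ p∣l! = contradiction p∣l! (prime∤! p-prime (p ∸ k) (ℕ.∸-monoʳ-< 0<k (ℕ.<⇒≤ k<p)))

-- A ring solver with integer coefficients

[m∸n]+n≡m+[n∸m] : ∀ m n → (m ∸ n) ℕ.+ n ≡ m ℕ.+ (n ∸ m)
[m∸n]+n≡m+[n∸m] zero    n       = ≡.cong (ℕ._+ n) (ℕ.0∸n≡0 n)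
[m∸n]+n≡m+[n∸m] (suc m) zero    = ≡.refl
[m∸n]+n≡m+[n∸m] (suc m) (suc n) = ≡.trans (ℕ.+-suc (m ∸ n) n) (≡.cong suc ([m∸n]+n≡m+[n∸m] m n))

module RingSolver {c ℓ : Level} (R : CommutativeRing c ℓ) where

  open CommutativeRing R
  open import Algebra.Properties.Ring ring
  open import Algebra.Properties.Semiring.Mult semiring using (_×_; ×-homo-+; ×1-homo-*; ×-homo-1; ×-congˡ)
  open import Algebra.Properties.CommutativeSemigroup +-commutativeSemigroup using (interchange)
  open import Relation.Binary.Reasoning.Setoid setoid

  -- (m , n) stands for the integer m - n.  Reducing every result makes the representation
  -- unique, so that the solver's normal forms agree definitionally.
  reduce : ℕ ∧ ℕ → ℕ ∧ ℕ
  reduce (m , n) = m ∸ n , n ∸ m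

  differences : RawRing _ _
  differences = record
    { Carrier = ℕ ∧ ℕ
    ; _≈_     = λ where (m , n) (m′ , n′) → m ℕ.+ n′ ≡ m′ ℕ.+ n
    ; _+_     = λ where (m , n) (m′ , n′) → reduce (m ℕ.+ m′ , n ℕ.+ n′)
    ; _*_     = λ where (m , n) (m′ , n′) → reduce (m ℕ.* m′ ℕ.+ n ℕ.* n′ , m ℕ.* n′ ℕ.+ n ℕ.* m′)
    ; -_      = λ where (m , n) → n , m
    ; 0#      = 0 , 0
    ; 1#      = 1 , 0
    }

  open RawRing differences using () renaming (_≈_ to _≈ᵈ_)

  ⟦_⟧ᵈ : ℕ ∧ ℕ → Carrier
  ⟦ m , n ⟧ᵈ = m × 1# - n × 1#

  [a+b]-[c+d] : ∀ a b c d → (a + b) - (c + d) ≈ (a - c) + (b - d)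
  [a+b]-[c+d] a b c d = trans (+-congˡ (sym (-‿+-comm c d))) (interchange a b (- c) (- d))

  cross-product : ∀ a b c d → (a - b) * (c - d) ≈ (a * c + b * d) - (a * d + b * c)
  cross-product a b c d = begin
    (a - b) * (c - d)                     ≈⟨ [y-z]x≈yx-zx (c - d) a b ⟩
    a * (c - d) - b * (c - d)             ≈⟨ +-cong (x[y-z]≈xy-xz a c d) (-‿cong (x[y-z]≈xy-xz b c d)) ⟩
    (a * c - a * d) - (b * c - b * d)     ≈⟨ +-congˡ (⁻¹-anti-homo‿- (b * c) (b * d)) ⟩
    (a * c - a * d) + (b * d - b * c)     ≈⟨ [a+b]-[c+d] _ _ _ _ ⟨
    (a * c + b * d) - (a * d + b * c)     ∎

  ≈ᵈ⇒≈ : ∀ {x y} → x ≈ᵈ y → ⟦ x ⟧ᵈ ≈ ⟦ y ⟧ᵈ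
  ≈ᵈ⇒≈ {m , n} {m′ , n′} eq = x∙y⁻¹≈ε⇒x≈y _ _ (begin
    (m × 1# - n × 1#) - (m′ × 1# - n′ × 1#)   ≈⟨ +-congˡ (⁻¹-anti-homo‿- _ _) ⟩
    (m × 1# - n × 1#) + (n′ × 1# - m′ × 1#)   ≈⟨ [a+b]-[c+d] _ _ _ _ ⟨
    (m × 1# + n′ × 1#) - (n × 1# + m′ × 1#)
      ≈⟨ +-cong (sym (×-homo-+ 1# m n′)) (-‿cong (trans (+-comm _ _) (sym (×-homo-+ 1# m′ n)))) ⟩
    (m ℕ.+ n′) × 1# - (m′ ℕ.+ n) × 1#         ≈⟨ +-congˡ (-‿cong (×-congˡ (≡.sym eq))) ⟩
    (m ℕ.+ n′) × 1# - (m ℕ.+ n′) × 1#         ≈⟨ -‿inverseʳ _ ⟩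
    0#                                        ∎)

  reduce≈ : ∀ m n → ⟦ reduce (m , n) ⟧ᵈ ≈ ⟦ m , n ⟧ᵈ
  reduce≈ m n = ≈ᵈ⇒≈ {reduce (m , n)} {m , n} ([m∸n]+n≡m+[n∸m] m n)

  homomorphism : differences -Raw-AlmostCommutative⟶ fromCommutativeRing R
  homomorphism = record
    { ⟦_⟧    = ⟦_⟧ᵈ
    ; +-homo = λ where
        (m , n) (m′ , n′) → trans (reduce≈ (m ℕ.+ m′) (n ℕ.+ n′)) (trans
          (+-cong (×-homo-+ 1# m m′) (-‿cong (×-homo-+ 1# n n′)))
          ([a+b]-[c+d] _ _ _ _))
    ; *-homo = λ where
        (m , n) (m′ , n′) → trans (reduce≈ (m ℕ.* m′ ℕ.+ n ℕ.* n′) (m ℕ.* n′ ℕ.+ n ℕ.* m′)) (begin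
          (m ℕ.* m′ ℕ.+ n ℕ.* n′) × 1# - (m ℕ.* n′ ℕ.+ n ℕ.* m′) × 1#
            ≈⟨ +-cong (expand m m′ n n′) (-‿cong (expand m n′ n m′)) ⟩
          (m × 1# * m′ × 1# + n × 1# * n′ × 1#) - (m × 1# * n′ × 1# + n × 1# * m′ × 1#)
            ≈⟨ cross-product _ _ _ _ ⟨
          ⟦ m , n ⟧ᵈ * ⟦ m′ , n′ ⟧ᵈ ∎)
    ; -‿homo = λ where (m , n) → sym (⁻¹-anti-homo‿- (m × 1#) (n × 1#))
    ; 0-homo = -‿inverseʳ 0#
    ; 1-homo = trans (+-cong (×-homo-1 1#) -0#≈0#) (+-identityʳ 1#)
    }
    where
    expand : ∀ m m′ n n′ → (m ℕ.* m′ ℕ.+ n ℕ.* n′) × 1# ≈ m × 1# * m′ × 1# + n × 1# * n′ × 1#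
    expand m m′ n n′ = trans (×-homo-+ 1# (m ℕ.* m′) (n ℕ.* n′)) (+-cong (×1-homo-* m m′) (×1-homo-* n n′))

  ⟦⟧ᵈ-≟ : ∀ x y → Maybe (⟦ x ⟧ᵈ ≈ ⟦ y ⟧ᵈ)
  ⟦⟧ᵈ-≟ x@(m , n) y@(m′ , n′) = Maybe.map (≈ᵈ⇒≈ {x} {y}) (dec⇒maybe (m ℕ.+ n′ ℕ.≟ m′ ℕ.+ n))

  open import Algebra.Solver.Ring differences (fromCommutativeRing R) homomorphism ⟦⟧ᵈ-≟
    public using (solve; _:=_; _:+_; _:*_; _:-_; :-_; con)

-- Additivity of the p-th power map in characteristic p

Annihilates : ∀ {c ℓ} → ℕ → CommutativeRing c ℓ → Set ℓ
Annihilates n R = n × 1# ≈ 0#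
  where
  open CommutativeRing R
  open import Algebra.Properties.Semiring.Mult semiring using (_×_)

module Frobenius {c ℓ : Level} (R : CommutativeRing c ℓ)
  {p : ℕ} (p-prime : Prime p) (char-p : Annihilates p R) where

  open CommutativeRing R
  open import Algebra.Properties.Monoid.Sum +-monoid using (sum; sum-cong-≋; sum-init-last; sum-replicate-zero)
  open import Algebra.Properties.Ring ring
  open import Algebra.Properties.Semiring.Mult semiring using (_×_; ×-congˡ; ×-congʳ; ×-assocˡ; ×-assoc-*; ×-homo-1)
  open import Algebra.Properties.CommutativeSemiring.Exp commutativeSemiring using (_^_; ^-congʳ; ^-congˡ)
  open import Algebra.Properties.CommutativeSemiring.Binomial commutativeSemiring using (theorem; binomialTerm)
  open import Relation.Binary.Reasoning.Setoid setoid

  char∣⇒×≈0 : ∀ {n} → p ℕ.∣ n → ∀ x → n × x ≈ 0#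
  char∣⇒×≈0 (divides q ≡.refl) x = begin
    (q ℕ.* p) × x      ≈⟨ ×-congˡ (ℕ.*-comm q p) ⟩
    (p ℕ.* q) × x      ≈⟨ ×-assocˡ x p q ⟨
    p × (q × x)        ≈⟨ ×-congʳ p (*-identityˡ _) ⟨
    p × (1# * q × x)   ≈⟨ ×-assoc-* p 1# (q × x) ⟨
    (p × 1#) * q × x   ≈⟨ *-congʳ char-p ⟩
    0# * q × x         ≈⟨ zeroˡ _ ⟩
    0#                 ∎

  0^p≈0 : 0# ^ p ≈ 0#
  0^p≈0 = helper p p-prime
    where
    helper : ∀ n → Prime n → 0# ^ n ≈ 0#
    helper zero    0-prime = contradiction 0-prime ¬prime[0]
    helper (suc n) _       = zeroˡ _

  ^p-distrib-+ : ∀ x y → (x + y) ^ p ≈ x ^ p + y ^ p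
  ^p-distrib-+ x y = trans (theorem p x y) (expansion p ≡.refl)
    where
    -- `p` is renamed to `n`, so that the exponent can be split as a successor and the two outer
    -- terms peeled off the binomial sum.
    expansion : ∀ n → n ≡ p → sum (binomialTerm x y n) ≈ x ^ n + y ^ n
    expansion zero    ≡.refl = contradiction p-prime ¬prime[0]
    expansion (suc n) ≡.refl = begin
      term fzero + sum (term ∘ fsuc)
        ≈⟨ +-congˡ (sum-init-last (term ∘ fsuc)) ⟩
      term fzero + (sum (term ∘ fsuc ∘ inject₁) + term (fsuc (fromℕ n)))
        ≈⟨ +-congˡ (+-congʳ (trans (sum-cong-≋ middle) (sum-replicate-zero n))) ⟩
      term fzero + (0# + term (fsuc (fromℕ n)))
        ≈⟨ +-congˡ (+-identityˡ _) ⟩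
      term fzero + term (fsuc (fromℕ n))
        ≈⟨ +-cong first (last (fromℕ n) (toℕ-fromℕ n)) ⟩
      y ^ suc n + x ^ suc n
        ≈⟨ +-comm _ _ ⟩
      x ^ suc n + y ^ suc n ∎
      where
      term = binomialTerm x y (suc n)
      first : term fzero ≈ y ^ suc n
      first = trans (×-homo-1 _) (*-identityˡ _)
      middle : ∀ i → term (fsuc (inject₁ i)) ≈ 0#
      middle i = char∣⇒×≈0
        (prime∣binomial p-prime ℕ.z<s (s≤s (≡.subst (_< n) (≡.sym (toℕ-inject₁ i)) (toℕ<n i)))) _
      last : ∀ j → toℕ j ≡ n → term (fsuc j) ≈ x ^ suc n
      last j eq rewrite eq = begin
        (suc n C suc n) × (x ^ suc n * y ^ (n ∸ n)) ≈⟨ ×-congˡ (nCn≡1 (suc n)) ⟩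
        1 × (x ^ suc n * y ^ (n ∸ n))               ≈⟨ ×-homo-1 _ ⟩
        x ^ suc n * y ^ (n ∸ n)                     ≈⟨ *-congˡ (^-congʳ y (ℕ.n∸n≡0 n)) ⟩
        x ^ suc n * 1#                              ≈⟨ *-identityʳ _ ⟩
        x ^ suc n                                   ∎

  ^p-‿homo : ∀ x → (- x) ^ p ≈ - (x ^ p)
  ^p-‿homo x = +-inverseˡ-unique _ _ (begin
    (- x) ^ p + x ^ p   ≈⟨ ^p-distrib-+ (- x) x ⟨
    (- x + x) ^ p       ≈⟨ ^-congˡ p (-‿inverseˡ x) ⟩
    0# ^ p              ≈⟨ 0^p≈0 ⟩
    0#                  ∎)

  ^p-distrib-- : ∀ x y → (x - y) ^ p ≈ x ^ p - y ^ p
  ^p-distrib-- x y = trans (^p-distrib-+ x (- y)) (+-congˡ (^p-‿homo y))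

-- The ring of polynomials and composition

module PolynomialRing {c ℓ : Level} (R : CommutativeRing c ℓ) where

  open CommutativeRing R
  open Polynomials R
  open import Algebra.Properties.Ring ring using (-0#≈0#)
  open import Algebra.Properties.CommutativeSemigroup +-commutativeSemigroup using (interchange; x∙yz≈y∙xz)

  -- _≈ₚ_ as a record, so that the two polynomials can be inferred from a proof.
  infix 4 _≋_
  record _≋_ (f g : Poly) : Set ℓ where
    constructor coefficientwise
    field at : f ≈ₚ g
  open _≋_ public

  ≋-refl : ∀ {f} → f ≋ f
  ≋-refl = coefficientwise λ _ → refl

  ≋-sym : ∀ {f g} → f ≋ g → g ≋ f
  ≋-sym f≋g = coefficientwise λ n → sym (f≋g .at n)

  ≋-trans : ∀ {f g h} → f ≋ g → g ≋ h → f ≋ h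
  ≋-trans f≋g g≋h = coefficientwise λ n → trans (f≋g .at n) (g≋h .at n)

  ∷-cong : ∀ {a b f g} → a ≈ b → f ≋ g → a ∷ f ≋ b ∷ g
  ∷-cong a≈b f≋g = coefficientwise λ where
    zero    → a≈b
    (suc n) → f≋g .at n

  ∷≋[] : ∀ {a f} → a ≈ 0# → f ≋ [] → a ∷ f ≋ []
  ∷≋[] a≈0 f≋[] = coefficientwise λ where
    zero    → a≈0
    (suc n) → f≋[] .at n

  coeff-+ : ∀ f g n → coeff (f +ₚ g) n ≈ coeff f n + coeff g n
  coeff-+ []      g       n       = sym (+-identityˡ _)
  coeff-+ (a ∷ f) []      n       = sym (+-identityʳ _)
  coeff-+ (a ∷ f) (b ∷ g) zero    = refl
  coeff-+ (a ∷ f) (b ∷ g) (suc n) = coeff-+ f g n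

  coeff-- : ∀ f n → coeff (-ₚ f) n ≈ - coeff f n
  coeff-- []      n       = sym -0#≈0#
  coeff-- (a ∷ f) zero    = refl
  coeff-- (a ∷ f) (suc n) = coeff-- f n

  coeff-· : ∀ a f n → coeff (a ·ₚ f) n ≈ a * coeff f n
  coeff-· a []      n       = sym (zeroʳ a)
  coeff-· a (b ∷ f) zero    = refl
  coeff-· a (b ∷ f) (suc n) = coeff-· a f n

  private
    via-+ : ∀ f g f′ g′ → (∀ n → coeff f n + coeff g n ≈ coeff f′ n + coeff g′ n) → f +ₚ g ≋ f′ +ₚ g′
    via-+ f g f′ g′ eq = coefficientwise λ n → trans (coeff-+ f g n) (trans (eq n) (sym (coeff-+ f′ g′ n)))

  +ₚ-cong : ∀ {f f′ g g′} → f ≋ f′ → g ≋ g′ → f +ₚ g ≋ f′ +ₚ g′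
  +ₚ-cong {f} {f′} {g} {g′} f≋f′ g≋g′ = via-+ f g f′ g′ λ n → +-cong (f≋f′ .at n) (g≋g′ .at n)

  +ₚ-comm : ∀ f g → f +ₚ g ≋ g +ₚ f
  +ₚ-comm f g = via-+ f g g f λ n → +-comm _ _

  +ₚ-assoc : ∀ f g h → (f +ₚ g) +ₚ h ≋ f +ₚ (g +ₚ h)
  +ₚ-assoc f g h = via-+ (f +ₚ g) h f (g +ₚ h) λ n →
    trans (+-congʳ (coeff-+ f g n)) (trans (+-assoc _ _ _) (+-congˡ (sym (coeff-+ g h n))))

  +ₚ-identityʳ : ∀ f → f +ₚ [] ≋ f
  +ₚ-identityʳ []      = ≋-refl
  +ₚ-identityʳ (_ ∷ _) = ≋-refl

  -ₚ-cong : ∀ {f g} → f ≋ g → -ₚ f ≋ -ₚ g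
  -ₚ-cong {f} {g} f≋g = coefficientwise λ n →
    trans (coeff-- f n) (trans (-‿cong (f≋g .at n)) (sym (coeff-- g n)))

  -ₚ-inverseʳ : ∀ f → f +ₚ (-ₚ f) ≋ []
  -ₚ-inverseʳ f = coefficientwise λ n →
    trans (coeff-+ f (-ₚ f) n) (trans (+-congˡ (coeff-- f n)) (-‿inverseʳ _))

  ·ₚ-cong : ∀ {a b f g} → a ≈ b → f ≋ g → a ·ₚ f ≋ b ·ₚ g
  ·ₚ-cong {a} {b} {f} {g} a≈b f≋g = coefficientwise λ n →
    trans (coeff-· a f n) (trans (*-cong a≈b (f≋g .at n)) (sym (coeff-· b g n)))

  ·ₚ-distribˡ : ∀ a f g → a ·ₚ (f +ₚ g) ≋ a ·ₚ f +ₚ a ·ₚ g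
  ·ₚ-distribˡ a []      g       = ≋-refl
  ·ₚ-distribˡ a (b ∷ f) []      = ≋-refl
  ·ₚ-distribˡ a (b ∷ f) (c ∷ g) = ∷-cong (distribˡ a b c) (·ₚ-distribˡ a f g)

  ·ₚ-distribʳ : ∀ f a b → (a + b) ·ₚ f ≋ a ·ₚ f +ₚ b ·ₚ f
  ·ₚ-distribʳ []      a b = ≋-refl
  ·ₚ-distribʳ (c ∷ f) a b = ∷-cong (distribʳ c a b) (·ₚ-distribʳ f a b)

  ·ₚ-assoc : ∀ a b f → (a * b) ·ₚ f ≋ a ·ₚ (b ·ₚ f)
  ·ₚ-assoc a b []      = ≋-refl
  ·ₚ-assoc a b (c ∷ f) = ∷-cong (*-assoc a b c) (·ₚ-assoc a b f)

  ·ₚ-zero : ∀ {a} → a ≈ 0# → ∀ f → a ·ₚ f ≋ []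
  ·ₚ-zero {a} a≈0 f = coefficientwise λ n → trans (coeff-· a f n) (trans (*-congʳ a≈0) (zeroˡ _))

  ·ₚ-one : ∀ f → 1# ·ₚ f ≋ f
  ·ₚ-one f = coefficientwise λ n → trans (coeff-· 1# f n) (*-identityˡ _)

  *ₚ-zeroʳ : ∀ f → f *ₚ [] ≋ []
  *ₚ-zeroʳ []      = ≋-refl
  *ₚ-zeroʳ (a ∷ f) = ∷≋[] refl (*ₚ-zeroʳ f)

  *ₚ-congˡ : ∀ f {g h} → g ≋ h → f *ₚ g ≋ f *ₚ h
  *ₚ-congˡ []      g≋h = ≋-refl
  *ₚ-congˡ (a ∷ f) g≋h = +ₚ-cong (·ₚ-cong refl g≋h) (∷-cong refl (*ₚ-congˡ f g≋h))

  -- `_*ₚ_` recurses on its left factor; the mirrored recursion on the right factor turns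
  -- commutativity into an induction.
  *ₚ-∷ : ∀ g a f → g *ₚ (a ∷ f) ≋ a ·ₚ g +ₚ (0# ∷ (g *ₚ f))
  *ₚ-∷ []      a f = coefficientwise λ where
    zero    → refl
    (suc n) → refl
  *ₚ-∷ (b ∷ g) a f = ∷-cong (+-congʳ (*-comm b a))
    (≋-trans (+ₚ-cong {b ·ₚ f} ≋-refl (*ₚ-∷ g a f)) (exchange (b ·ₚ f) (a ·ₚ g) (0# ∷ (g *ₚ f))))
    where
    exchange : ∀ u v w → u +ₚ (v +ₚ w) ≋ v +ₚ (u +ₚ w)
    exchange u v w = via-+ u (v +ₚ w) v (u +ₚ w) λ n →
      trans (+-congˡ (coeff-+ v w n)) (trans (x∙yz≈y∙xz _ _ _) (+-congˡ (sym (coeff-+ u w n))))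

  *ₚ-comm : ∀ f g → f *ₚ g ≋ g *ₚ f
  *ₚ-comm []      g = ≋-sym (*ₚ-zeroʳ g)
  *ₚ-comm (a ∷ f) g = ≋-trans (+ₚ-cong {a ·ₚ g} ≋-refl (∷-cong refl (*ₚ-comm f g))) (≋-sym (*ₚ-∷ g a f))

  *ₚ-cong : ∀ {f f′ g g′} → f ≋ f′ → g ≋ g′ → f *ₚ g ≋ f′ *ₚ g′
  *ₚ-cong {f} {f′} {g} {g′} f≋f′ g≋g′ = ≋-trans (*ₚ-congˡ f g≋g′)
    (≋-trans (*ₚ-comm f g′) (≋-trans (*ₚ-congˡ g′ f≋f′) (*ₚ-comm g′ f′)))

  *ₚ-distribʳ : ∀ h f g → (f +ₚ g) *ₚ h ≋ f *ₚ h +ₚ g *ₚ h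
  *ₚ-distribʳ h []      g       = ≋-refl
  *ₚ-distribʳ h (a ∷ f) []      = ≋-sym (+ₚ-identityʳ _)
  *ₚ-distribʳ h (a ∷ f) (b ∷ g) = ≋-trans
    (+ₚ-cong (·ₚ-distribʳ h a b) (∷-cong (sym (+-identityˡ 0#)) (*ₚ-distribʳ h f g)))
    (swap (a ·ₚ h) (b ·ₚ h) (0# ∷ (f *ₚ h)) (0# ∷ (g *ₚ h)))
    where
    swap : ∀ u v w z → (u +ₚ v) +ₚ (w +ₚ z) ≋ (u +ₚ w) +ₚ (v +ₚ z)
    swap u v w z = via-+ (u +ₚ v) (w +ₚ z) (u +ₚ w) (v +ₚ z) λ n → trans
      (+-cong (coeff-+ u v n) (coeff-+ w z n))
      (trans (interchange _ _ _ _) (sym (+-cong (coeff-+ u w n) (coeff-+ v z n))))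

  ·ₚ-*ₚ : ∀ a f g → (a ·ₚ f) *ₚ g ≋ a ·ₚ (f *ₚ g)
  ·ₚ-*ₚ a []      g = ≋-refl
  ·ₚ-*ₚ a (b ∷ f) g = ≋-trans
    (+ₚ-cong (·ₚ-assoc a b g) (∷-cong (sym (zeroʳ a)) (·ₚ-*ₚ a f g)))
    (≋-sym (·ₚ-distribˡ a (b ·ₚ g) (0# ∷ (f *ₚ g))))

  0∷-*ₚ : ∀ f g → (0# ∷ f) *ₚ g ≋ 0# ∷ (f *ₚ g)
  0∷-*ₚ f g = +ₚ-cong {g = 0# ∷ (f *ₚ g)} (·ₚ-zero refl g) ≋-refl

  *ₚ-assoc : ∀ f g h → (f *ₚ g) *ₚ h ≋ f *ₚ (g *ₚ h)
  *ₚ-assoc []      g h = ≋-refl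
  *ₚ-assoc (a ∷ f) g h = ≋-trans (*ₚ-distribʳ h (a ·ₚ g) (0# ∷ (f *ₚ g)))
    (+ₚ-cong (·ₚ-*ₚ a g h) (≋-trans (0∷-*ₚ (f *ₚ g) h) (∷-cong refl (*ₚ-assoc f g h))))

  constant-* : ∀ a f → constant a *ₚ f ≋ a ·ₚ f
  constant-* a f = ≋-trans (+ₚ-cong {a ·ₚ f} ≋-refl (∷≋[] refl ≋-refl)) (+ₚ-identityʳ _)

  *ₚ-identityˡ : ∀ f → constant 1# *ₚ f ≋ f
  *ₚ-identityˡ f = ≋-trans (constant-* 1# f) (·ₚ-one f)

  polynomialRing : CommutativeRing c ℓ
  polynomialRing = record
    { Carrier = Poly
    ; _≈_     = _≋_
    ; _+_     = _+ₚ_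
    ; _*_     = _*ₚ_
    ; -_      = -ₚ_
    ; 0#      = []
    ; 1#      = constant 1#
    ; isCommutativeRing = record
      { isRing = record
        { +-isAbelianGroup = record
          { isGroup = record
            { isMonoid = record
              { isSemigroup = record
                { isMagma = record
                  { isEquivalence = record { refl = ≋-refl ; sym = ≋-sym ; trans = ≋-trans }
                  ; ∙-cong = +ₚ-cong
                  }
                ; assoc = +ₚ-assoc
                }
              ; identity = (λ _ → ≋-refl) , +ₚ-identityʳ
              }
            ; inverse = (λ f → ≋-trans (+ₚ-comm (-ₚ f) f) (-ₚ-inverseʳ f)) , -ₚ-inverseʳ
            ; ⁻¹-cong = -ₚ-cong
            }
          ; comm = +ₚ-comm
          }
        ; *-cong = *ₚ-cong
        ; *-assoc = *ₚ-assoc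
        ; *-identity = *ₚ-identityˡ , λ f → ≋-trans (*ₚ-comm f _) (*ₚ-identityˡ f)
        ; distrib =
            (λ f g h → ≋-trans (*ₚ-comm f (g +ₚ h))
              (≋-trans (*ₚ-distribʳ f g h) (+ₚ-cong (*ₚ-comm g f) (*ₚ-comm h f)))) ,
            *ₚ-distribʳ
        }
      ; *-comm = *ₚ-comm
      }
    }

  module P = CommutativeRing polynomialRing
  open import Algebra.Properties.CommutativeSemiring.Exp commutativeSemiring using (_^_)
  open import Algebra.Properties.CommutativeSemiring.Exp P.commutativeSemiring
    using () renaming (_^_ to _^ₚ_)
  open import Algebra.Properties.Semiring.Mult semiring using (_×_)
  open import Algebra.Properties.Semiring.Mult P.semiring using () renaming (_×_ to _×ₚ_)
  open import Relation.Binary.Reasoning.Setoid P.setoid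
  import Algebra.Properties.Ring P.ring as PRing
  open import Algebra.Properties.CommutativeSemigroup P.+-commutativeSemigroup
    using () renaming (interchange to +ₚ-interchange)
  open import Algebra.Properties.CommutativeSemigroup P.*-commutativeSemigroup
    using () renaming (x∙yz≈y∙xz to f*gh≋g*fh)

  constant-cong : ∀ {a b} → a ≈ b → constant a ≋ constant b
  constant-cong a≈b = ∷-cong a≈b ≋-refl

  constant-*-homo : ∀ a b → constant (a * b) ≋ constant a *ₚ constant b
  constant-*-homo a b = ≋-sym (constant-* a (constant b))

  constant-0 : constant 0# ≋ []
  constant-0 = ∷≋[] refl ≋-refl

  constant-^-homo : ∀ a n → constant (a ^ n) ≋ constant a ^ₚ n
  constant-^-homo a zero    = ≋-refl
  constant-^-homo a (suc n) = ≋-trans (constant-*-homo a (a ^ n)) (P.*-congˡ {constant a} (constant-^-homo a n))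

  constant-×-homo : ∀ n a → constant (n × a) ≋ n ×ₚ constant a
  constant-×-homo zero    a = constant-0
  constant-×-homo (suc n) a = P.+-congˡ {constant a} (constant-×-homo n a)

  ∘ₚ-constant : ∀ a h → constant a ∘ₚ h ≋ constant a
  ∘ₚ-constant a h = P.+-congˡ {constant a} (*ₚ-zeroʳ h)

  ∘ₚ-+ : ∀ f g h → (f +ₚ g) ∘ₚ h ≋ f ∘ₚ h +ₚ g ∘ₚ h
  ∘ₚ-+ []      g       h = ≋-refl
  ∘ₚ-+ (a ∷ f) []      h = ≋-sym (+ₚ-identityʳ _)
  ∘ₚ-+ (a ∷ f) (b ∷ g) h = begin
    constant (a + b) +ₚ h *ₚ (f +ₚ g) ∘ₚ h
      ≈⟨ P.+-congˡ {constant (a + b)} (P.trans (P.*-congˡ {h} (∘ₚ-+ f g h)) (P.distribˡ h (f ∘ₚ h) (g ∘ₚ h))) ⟩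
    (constant a +ₚ constant b) +ₚ (h *ₚ f ∘ₚ h +ₚ h *ₚ g ∘ₚ h)
      ≈⟨ +ₚ-interchange (constant a) (constant b) (h *ₚ f ∘ₚ h) (h *ₚ g ∘ₚ h) ⟩
    (constant a +ₚ h *ₚ f ∘ₚ h) +ₚ (constant b +ₚ h *ₚ g ∘ₚ h) ∎

  ∘ₚ-neg : ∀ f h → (-ₚ f) ∘ₚ h ≋ -ₚ (f ∘ₚ h)
  ∘ₚ-neg []      h = ≋-refl
  ∘ₚ-neg (a ∷ f) h = begin
    -ₚ constant a +ₚ h *ₚ (-ₚ f) ∘ₚ h     ≈⟨ P.+-congˡ { -ₚ constant a} (P.*-congˡ {h} (∘ₚ-neg f h)) ⟩
    -ₚ constant a +ₚ h *ₚ (-ₚ (f ∘ₚ h))   ≈⟨ P.+-congˡ { -ₚ constant a} (PRing.-‿distribʳ-* h (f ∘ₚ h)) ⟨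
    -ₚ constant a +ₚ (-ₚ (h *ₚ f ∘ₚ h))   ≈⟨ PRing.-‿+-comm (constant a) (h *ₚ f ∘ₚ h) ⟩
    -ₚ (constant a +ₚ h *ₚ f ∘ₚ h)        ∎

  ∘ₚ-monomial : ∀ a n h → monomial a n ∘ₚ h ≋ constant a *ₚ h ^ₚ n
  ∘ₚ-monomial a zero    h = ≋-trans (∘ₚ-constant a h) (P.sym (P.*-identityʳ (constant a)))
  ∘ₚ-monomial a (suc n) h = begin
    constant 0# +ₚ h *ₚ monomial a n ∘ₚ h   ≈⟨ P.+-congʳ constant-0 ⟩
    h *ₚ monomial a n ∘ₚ h                  ≈⟨ P.*-congˡ {h} (∘ₚ-monomial a n h) ⟩
    h *ₚ (constant a *ₚ h ^ₚ n)             ≈⟨ f*gh≋g*fh h (constant a) (h ^ₚ n) ⟩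
    constant a *ₚ (h *ₚ h ^ₚ n)             ∎

  -- This removes Horner's scheme from the later arguments: they treat `f ∘ₚ g` as the expression
  -- `a gᵖ - b g - c`.
  ∘ₚ-trinomial : ∀ a b c p h → (monomial a p -ₚ monomial b 1 -ₚ constant c) ∘ₚ h ≋
                 constant a *ₚ h ^ₚ p -ₚ constant b *ₚ h -ₚ constant c
  ∘ₚ-trinomial a b c p h = begin
    (monomial a p -ₚ monomial b 1 -ₚ constant c) ∘ₚ h
      ≈⟨ ∘ₚ-+ (monomial a p -ₚ monomial b 1) (-ₚ constant c) h ⟩
    (monomial a p -ₚ monomial b 1) ∘ₚ h +ₚ (-ₚ constant c) ∘ₚ h
      ≈⟨ P.+-cong (∘ₚ-+ (monomial a p) (-ₚ monomial b 1) h) (∘ₚ-constant (- c) h) ⟩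
    (monomial a p ∘ₚ h +ₚ (-ₚ monomial b 1) ∘ₚ h) -ₚ constant c
      ≈⟨ P.+-congʳ (P.+-cong (∘ₚ-monomial a p h) (∘ₚ-neg (monomial b 1) h)) ⟩
    constant a *ₚ h ^ₚ p -ₚ monomial b 1 ∘ₚ h -ₚ constant c
      ≈⟨ P.+-congʳ (P.+-congˡ {constant a *ₚ h ^ₚ p} (P.-‿cong
          (P.trans (∘ₚ-monomial b 1 h) (P.*-congˡ {constant b} (P.*-identityʳ h))))) ⟩
    constant a *ₚ h ^ₚ p -ₚ constant b *ₚ h -ₚ constant c ∎

-- Degrees, division and the Euclidean algorithm over a field

record IsDiscreteField {c ℓ : Level} (R : CommutativeRing c ℓ) : Set (c ⊔ ℓ) where
  open CommutativeRing R
  field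
    1≉0     : ¬ (1# ≈ 0#)
    ≈0?     : ∀ x → Dec (x ≈ 0#)
    inverse : ∀ x → ¬ (x ≈ 0#) → ∃[ y ] y * x ≈ 1#

module PolynomialDegree {c ℓ : Level} (R : CommutativeRing c ℓ) (isDiscreteField : IsDiscreteField R) where

  open CommutativeRing R
  open IsDiscreteField isDiscreteField
  open Polynomials R
  open PolynomialRing R
  open import Algebra.Properties.Ring ring using (-0#≈0#)
  open import Algebra.Properties.CommutativeSemiring.Exp P.commutativeSemiring
    using () renaming (_^_ to _^ₚ_)
  open import Algebra.Properties.Semiring.Divisibility P.semiring using (_∣_; _,_)
  open import Relation.Binary.Reasoning.Setoid P.setoid
  open RingSolver polynomialRing

  xy≉0 : ∀ {x y} → ¬ (x ≈ 0#) → ¬ (y ≈ 0#) → ¬ (x * y ≈ 0#)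
  xy≉0 {x} {y} x≉0 y≉0 xy≈0 with inverse x x≉0
  ... | x⁻¹ , x⁻¹x≈1 = y≉0 (trans (sym (*-identityˡ y)) (trans (*-congʳ (sym x⁻¹x≈1))
    (trans (*-assoc x⁻¹ x y) (trans (*-congˡ xy≈0) (zeroʳ x⁻¹)))))

  -- A strict bound, so that the zero polynomial satisfies it for every `n`, including 0. The second
  -- half of `HasDegree f d` is definitionally `DegreeBelow f (suc d)`.
  DegreeBelow : Poly → ℕ → Set ℓ
  DegreeBelow f n = ∀ m → n ≤ m → coeff f m ≈ 0#

  DegreeBelow-mono : ∀ f {m n} → m ≤ n → DegreeBelow f m → DegreeBelow f n
  DegreeBelow-mono f m≤n f< k n≤k = f< k (ℕ.≤-trans m≤n n≤k)

  DegreeBelow-neg : ∀ f {n} → DegreeBelow f n → DegreeBelow (-ₚ f) n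
  DegreeBelow-neg f f< m n≤m = trans (coeff-- f m) (trans (-‿cong (f< m n≤m)) -0#≈0#)

  DegreeBelow-+ : ∀ f g {n} → DegreeBelow f n → DegreeBelow g n → DegreeBelow (f +ₚ g) n
  DegreeBelow-+ f g f< g< m n≤m =
    trans (coeff-+ f g m) (trans (+-cong (f< m n≤m) (g< m n≤m)) (+-identityˡ 0#))

  DegreeBelow-constant : ∀ a → DegreeBelow (constant a) 1
  DegreeBelow-constant a (suc m) (s≤s _) = refl

  DegreeBelow-length : ∀ f → DegreeBelow f (length f)
  DegreeBelow-length []      m       _         = refl
  DegreeBelow-length (a ∷ f) (suc m) (s≤s f≤m) = DegreeBelow-length f m f≤m

  DegreeBelow-* : ∀ f g d e → DegreeBelow f (suc d) → DegreeBelow g (suc e) → DegreeBelow (f *ₚ g) (suc (d ℕ.+ e))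
  DegreeBelow-* []      g d       e f< g< m       d+e<m       = refl
  DegreeBelow-* (a ∷ f) g zero    e f< g< (suc m) (s≤s e≤m) = trans
    (coeff-+ (a ·ₚ g) _ (suc m))
    (trans (+-cong
      (trans (coeff-· a g (suc m)) (trans (*-congˡ (g< (suc m) (s≤s e≤m))) (zeroʳ a)))
      (P.*-congʳ {g} {f} {[]} (coefficientwise λ n → f< (suc n) (s≤s z≤n)) .at m))
    (+-identityˡ 0#))
  DegreeBelow-* (a ∷ f) g (suc d) e f< g< (suc m) (s≤s d+e<m) = trans
    (coeff-+ (a ·ₚ g) _ (suc m))
    (trans (+-cong
      (trans (coeff-· a g (suc m)) (trans (*-congˡ (g< (suc m) (s≤s (ℕ.≤-trans (ℕ.m≤n+m e (suc d)) d+e<m)))) (zeroʳ a)))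
      (DegreeBelow-* f g d e (λ n d<n → f< (suc n) (s≤s d<n)) g< m d+e<m))
    (+-identityˡ 0#))

  coeff-*-top : ∀ f g d e → DegreeBelow f (suc d) → DegreeBelow g (suc e) →
                coeff (f *ₚ g) (d ℕ.+ e) ≈ coeff f d * coeff g e
  coeff-*-top []      g d       e f< g< = sym (zeroˡ _)
  coeff-*-top (a ∷ f) g zero    e f< g< = trans
    (coeff-+ (a ·ₚ g) _ e)
    (trans (+-cong (coeff-· a g e)
      (∷≋[] {0#} refl (P.*-congʳ {g} {f} {[]} (coefficientwise λ n → f< (suc n) (s≤s z≤n))) .at e))
    (+-identityʳ _))
  coeff-*-top (a ∷ f) g (suc d) e f< g< = trans
    (coeff-+ (a ·ₚ g) _ (suc d ℕ.+ e))
    (trans (+-cong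
      (trans (coeff-· a g (suc d ℕ.+ e)) (trans (*-congˡ (g< _ (s≤s (ℕ.m≤n+m e d)))) (zeroʳ a)))
      (coeff-*-top f g d e (λ n d<n → f< (suc n) (s≤s d<n)) g<))
    (+-identityˡ _))

  HasDegree-cong : ∀ {f g d} → f ≋ g → HasDegree f d → HasDegree g d
  HasDegree-cong {d = d} f≋g (lead , f<) =
    (λ g≈0 → lead (trans (f≋g .at d) g≈0)) , λ n d<n → trans (sym (f≋g .at n)) (f< n d<n)

  HasDegree-unique : ∀ f {d e} → HasDegree f d → HasDegree f e → d ≡ e
  HasDegree-unique f {d} {e} (d-lead , d-below) (e-lead , e-below) with ℕ.<-cmp d e
  ... | tri< d<e _ _ = contradiction (d-below e d<e) e-lead
  ... | tri≈ _ d≡e _ = d≡e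
  ... | tri> _ _ e<d = contradiction (e-below d e<d) d-lead

  HasDegree⇒≋̸[] : ∀ f {d} → HasDegree f d → ¬ (f ≋ [])
  HasDegree⇒≋̸[] f {d} (lead , _) f≋[] = lead (f≋[] .at d)

  HasDegree-* : ∀ f g {d e} → HasDegree f d → HasDegree g e → HasDegree (f *ₚ g) (d ℕ.+ e)
  HasDegree-* f g {d} {e} (f-lead , f<) (g-lead , g<) =
    (λ eq → xy≉0 f-lead g-lead (trans (sym (coeff-*-top f g d e f< g<)) eq)) , DegreeBelow-* f g d e f< g<

  HasDegree-constant : ∀ {a} → ¬ (a ≈ 0#) → HasDegree (constant a) 0
  HasDegree-constant {a} a≉0 = a≉0 , DegreeBelow-constant a

  HasDegree-X : HasDegree X 1
  HasDegree-X = 1≉0 , λ where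
    (suc (suc n)) _ → refl
    (suc zero) (s≤s ())

  HasDegree-^ : ∀ f {d} n → HasDegree f d → HasDegree (f ^ₚ n) (n ℕ.* d)
  HasDegree-^ f zero    deg = HasDegree-constant 1≉0
  HasDegree-^ f (suc n) deg = HasDegree-* f (f ^ₚ n) deg (HasDegree-^ f n deg)

  HasDegree-+-lower : ∀ f g {d} → HasDegree f d → DegreeBelow g d → HasDegree (f +ₚ g) d
  HasDegree-+-lower f g {d} (lead , f<) g< =
    (λ eq → lead (trans (sym (trans (coeff-+ f g d) (trans (+-congˡ (g< d ℕ.≤-refl)) (+-identityʳ _)))) eq)) ,
    DegreeBelow-+ f g f< (DegreeBelow-mono g (ℕ.n≤1+n d) g<)

  -- As `d < e`, the leading terms cannot cancel. The coefficients of `v` come out of existence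
  -- arguments and may vanish, so only a range for the degree is recorded.
  HasDegree-+-multiple : ∀ f g {d e} → HasDegree f d → HasDegree g e → d < e → ∀ a →
                         ∃[ k ] (d ≤ k ∧ k ≤ e ∧ HasDegree (f +ₚ constant a *ₚ g) k)
  HasDegree-+-multiple f g {d} {e} f-deg g-deg d<e a with ≈0? a
  ... | yes a≈0 = d , ℕ.≤-refl , ℕ.<⇒≤ d<e , HasDegree-cong {f} (≋-sym f+ag≋f) f-deg
    where
    f+ag≋f : f +ₚ constant a *ₚ g ≋ f
    f+ag≋f = P.trans (P.+-congˡ {f} (P.trans (constant-* a g) (·ₚ-zero a≈0 g))) (P.+-identityʳ f)
  ... | no  a≉0 = e , ℕ.<⇒≤ d<e , ℕ.≤-refl ,
    HasDegree-cong {constant a *ₚ g +ₚ f} (P.+-comm _ f)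
      (HasDegree-+-lower (constant a *ₚ g) f (HasDegree-* (constant a) g (HasDegree-constant a≉0) g-deg)
        (DegreeBelow-mono f d<e (proj₂ f-deg)))

  HasDegree-trinomial : ∀ {a} h {n} b c p → ¬ (a ≈ 0#) → HasDegree h n → 1 ≤ n → 2 ≤ p →
                        HasDegree (constant a *ₚ h ^ₚ p -ₚ constant b *ₚ h -ₚ constant c) (p ℕ.* n)
  HasDegree-trinomial {a} h {n@(suc _)} b c p a≉0 h-deg _ 2≤p =
    HasDegree-+-lower (constant a *ₚ h ^ₚ p -ₚ constant b *ₚ h) (-ₚ constant c)
      (HasDegree-+-lower (constant a *ₚ h ^ₚ p) (-ₚ (constant b *ₚ h))
        (HasDegree-* (constant a) (h ^ₚ p) (HasDegree-constant a≉0) (HasDegree-^ h p h-deg))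
        (DegreeBelow-neg (constant b *ₚ h) (DegreeBelow-mono (constant b *ₚ h) n<pn
          (DegreeBelow-* (constant b) h 0 n (DegreeBelow-constant b) (proj₂ h-deg)))))
      (DegreeBelow-neg (constant c) (DegreeBelow-mono (constant c) (ℕ.≤-trans (s≤s z≤n) n<pn) (DegreeBelow-constant c)))
    where
    n<pn : n < p ℕ.* n
    n<pn = ≡.subst (n <_) (ℕ.*-comm n p) (ℕ.m<m*n n p 2≤p)

  -- Coefficients are tested from the top down. For a remainder, the bound on `d` is the decrease
  -- that drives the Euclidean algorithm.
  zero-or-degree-below : ∀ n f → DegreeBelow f n → f ≋ [] ⊎ (∃[ d ] d < n ∧ HasDegree f d)
  zero-or-degree-below zero    f f< = inj₁ (coefficientwise λ n → f< n z≤n)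
  zero-or-degree-below (suc n) f f< with ≈0? (coeff f n)
  ... | no  fₙ≉0 = inj₂ (n , ℕ.≤-refl , fₙ≉0 , f<)
  ... | yes fₙ≈0 with zero-or-degree-below n f (λ m n≤m → below m (ℕ.m≤n⇒m<n∨m≡n n≤m))
    where
    below : ∀ m → n < m ⊎ n ≡ m → coeff f m ≈ 0#
    below m (inj₁ n<m)    = f< m n<m
    below m (inj₂ ≡.refl) = fₙ≈0
  ...   | inj₁ f≋[]           = inj₁ f≋[]
  ...   | inj₂ (d , d<n , deg) = inj₂ (d , ℕ.m<n⇒m<1+n d<n , deg)

  zero-or-degree : ∀ f → f ≋ [] ⊎ (∃[ d ] HasDegree f d)
  zero-or-degree f with zero-or-degree-below (length f) f (DegreeBelow-length f)
  ... | inj₁ f≋[]          = inj₁ f≋[]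
  ... | inj₂ (d , _ , deg) = inj₂ (d , deg)

  -- Horner induction on the dividend: `f = g q + r` gives `a + x f = g (x q) + (a + x r)`. Here
  -- `a + x r` has degree at most `m`, so subtracting the multiple `t g` that cancels its
  -- coefficient at `m` suffices.
  division : ∀ f {g m} → HasDegree g m → ∃[ q ] ∃[ r ] (f ≋ g *ₚ q +ₚ r ∧ DegreeBelow r m)
  division []      {g} g-deg = [] , [] , ≋-sym (P.trans (P.+-identityʳ (g *ₚ [])) (*ₚ-zeroʳ g)) , λ _ _ → refl
  division (a ∷ f) {g} {m} g-deg@(lead , g<) with division f {g} g-deg | inverse (coeff g m) lead
  ... | q , r , f≋gq+r , r< | g⁻¹ , g⁻¹g≈1 =
    (0# ∷ q) +ₚ constant t , (a ∷ r) -ₚ t ·ₚ g , decomposition , remainder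
    where
    t : Carrier
    t = coeff (a ∷ r) m * g⁻¹

    shifted : a ∷ f ≋ g *ₚ (0# ∷ q) +ₚ (a ∷ r)
    shifted = begin
      a ∷ f                                  ≈⟨ ∷-cong (sym (+-identityˡ a)) f≋gq+r ⟩
      (0# ∷ (g *ₚ q)) +ₚ (a ∷ r)
        ≈⟨ P.+-congʳ {a ∷ r} (P.sym (P.trans (*ₚ-∷ g 0# q) (P.+-congʳ {0# ∷ (g *ₚ q)} (·ₚ-zero refl g)))) ⟩
      g *ₚ (0# ∷ q) +ₚ (a ∷ r)               ∎

    decomposition : a ∷ f ≋ g *ₚ ((0# ∷ q) +ₚ constant t) +ₚ ((a ∷ r) -ₚ t ·ₚ g)
    decomposition = begin
      a ∷ f
        ≈⟨ shifted ⟩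
      g *ₚ (0# ∷ q) +ₚ (a ∷ r)
        ≈⟨ solve 4 (λ g q r t →
             g :* q :+ r
             := g :* (q :+ t) :+ (r :- t :* g))
             P.refl g (0# ∷ q) (a ∷ r) (constant t) ⟩
      g *ₚ ((0# ∷ q) +ₚ constant t) +ₚ ((a ∷ r) -ₚ constant t *ₚ g)
        ≈⟨ P.+-congˡ {g *ₚ ((0# ∷ q) +ₚ constant t)} (P.+-congˡ {a ∷ r} (P.-‿cong (constant-* t g))) ⟩
      g *ₚ ((0# ∷ q) +ₚ constant t) +ₚ ((a ∷ r) -ₚ t ·ₚ g) ∎

    coeff-remainder : ∀ k → coeff ((a ∷ r) -ₚ t ·ₚ g) k ≈ coeff (a ∷ r) k - t * coeff g k
    coeff-remainder k = trans (coeff-+ (a ∷ r) (-ₚ (t ·ₚ g)) k)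
      (+-congˡ (trans (coeff-- (t ·ₚ g) k) (-‿cong (coeff-· t g k))))

    vanishes : ∀ k → m < k ⊎ m ≡ k → coeff (a ∷ r) k - t * coeff g k ≈ 0#
    vanishes (suc k) (inj₁ (s≤s m≤k)) = trans
      (+-cong (r< k m≤k) (-‿cong (trans (*-congˡ (g< (suc k) (s≤s m≤k))) (zeroʳ t))))
      (-‿inverseʳ 0#)
    vanishes k (inj₂ ≡.refl) = trans
      (+-congˡ (-‿cong (trans (*-assoc _ g⁻¹ _) (trans (*-congˡ g⁻¹g≈1) (*-identityʳ _)))))
      (-‿inverseʳ _)

    remainder : DegreeBelow ((a ∷ r) -ₚ t ·ₚ g) m
    remainder k m≤k = trans (coeff-remainder k) (vanishes k (ℕ.m≤n⇒m<n∨m≡n m≤k))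

  -- Degrees add up in `f = g h`, so a constant cofactor would give `g` the degree of `f`.
  reducible-if-nontrivial-divisor : ∀ {f g h d m} → HasDegree f d → HasDegree g (suc m) → suc m < d →
                                    f ≋ g *ₚ h → Reducible f
  reducible-if-nontrivial-divisor {f} {g} {h} {d} {m} f-deg g-deg m<d f≋gh with zero-or-degree h
  ... | inj₁ h≋[] = contradiction (P.trans f≋gh (P.trans (P.*-congˡ {g} h≋[]) (*ₚ-zeroʳ g))) (HasDegree⇒≋̸[] f f-deg)
  ... | inj₂ (zero , h-deg) = contradiction
    (≡.trans
      (HasDegree-unique f f-deg (HasDegree-cong {g *ₚ h} (P.sym f≋gh) (HasDegree-* g h g-deg h-deg)))
      (ℕ.+-identityʳ (suc m)))
    (ℕ.>⇒≢ m<d)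
  ... | inj₂ (suc e , h-deg) = g , h , (m , g-deg) , (e , h-deg) , f≋gh .at

  -- The Euclidean algorithm on f and g either finds a common factor of f and g, or reaches a
  -- constant, while keeping the invariant f ∣ g h.
  reducible-or-∣ : ∀ k {f d} g h m → HasDegree f d → HasDegree g m → m < k → m < d →
                   f ∣ g *ₚ h → Reducible f ⊎ f ∣ h
  reducible-or-∣ (suc k) {f} {d} g h zero f-deg (lead , g<) _ _ (q , qf≋gh) with inverse (coeff g 0) lead
  ... | g⁻¹ , g⁻¹g≈1 = inj₂ (constant g⁻¹ *ₚ q , (begin
    (constant g⁻¹ *ₚ q) *ₚ f           ≈⟨ P.*-assoc (constant g⁻¹) q f ⟩
    constant g⁻¹ *ₚ (q *ₚ f)           ≈⟨ P.*-congˡ {constant g⁻¹} (P.trans qf≋gh (P.*-congʳ {h} g≋constant)) ⟩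
    constant g⁻¹ *ₚ (constant (coeff g 0) *ₚ h)  ≈⟨ P.*-assoc (constant g⁻¹) (constant (coeff g 0)) h ⟨
    (constant g⁻¹ *ₚ constant (coeff g 0)) *ₚ h
      ≈⟨ P.*-congʳ {h} (P.trans (P.sym (constant-*-homo g⁻¹ (coeff g 0))) (constant-cong g⁻¹g≈1)) ⟩
    constant 1# *ₚ h                   ≈⟨ P.*-identityˡ h ⟩
    h                                  ∎))
    where
    g≋constant : g ≋ constant (coeff g 0)
    g≋constant = coefficientwise λ where
      zero    → refl
      (suc n) → g< (suc n) (s≤s z≤n)
  -- `f` remains the dividend throughout: `g` is replaced by the shorter `f` mod `g`, and a zero
  -- remainder makes the current `g` a proper factor of `f`.
  reducible-or-∣ (suc k) {f} {d} g h (suc m) f-deg g-deg (s≤s m<k) m<d (q , qf≋gh) with division f {g} g-deg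
  ... | s , r , f≋gs+r , r< with zero-or-degree-below (suc m) r r<
  ...   | inj₁ r≋[] = inj₁ (reducible-if-nontrivial-divisor {f} {g} {s} f-deg g-deg m<d
    (P.trans f≋gs+r (P.trans (P.+-congˡ {g *ₚ s} r≋[]) (P.+-identityʳ (g *ₚ s)))))
  ...   | inj₂ (m′ , m′<m , r-deg) = reducible-or-∣ k r h m′ f-deg r-deg (ℕ.≤-trans m′<m m<k) (ℕ.<-trans m′<m m<d)
    -- Since `r = f - g s` and `g h = q f`, the product `r h` is `f h - s (q f)`.
    (h -ₚ q *ₚ s , (begin
      (h -ₚ q *ₚ s) *ₚ f
        ≈⟨ solve 4 (λ f h q s →
             (h :- q :* s) :* f
             := f :* h :- s :* (q :* f))
             P.refl f h q s ⟩
      f *ₚ h -ₚ s *ₚ (q *ₚ f)       ≈⟨ P.+-cong (P.*-congʳ {h} f≋gs+r) (P.-‿cong (P.*-congˡ {s} qf≋gh)) ⟩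
      (g *ₚ s +ₚ r) *ₚ h -ₚ s *ₚ (g *ₚ h)
        ≈⟨ solve 4 (λ g h r s →
             (g :* s :+ r) :* h :- s :* (g :* h)
             := r :* h)
             P.refl g h r s ⟩
      r *ₚ h                        ∎))

  -- Each factor either splits `f` or can be cancelled from the product; if all are cancelled, `f`
  -- divides `constant 1#`, which its positive degree forbids. The product ends in `constant 1#`,
  -- whence the trailing units in the factorizations supplied to it.
  reducible-if-∣-product : ∀ {f d} gs → HasDegree f d → 0 < d → All (λ g → ∃[ m ] (m < d ∧ HasDegree g m)) gs →
                           f ∣ foldr _*ₚ_ (constant 1#) gs → Reducible f
  reducible-if-∣-product {f} [] f-deg 0<d [] (q , qf≋1) with zero-or-degree q
  ... | inj₁ q≋[] = contradiction
    (P.trans (P.sym qf≋1) (P.*-congʳ {f} q≋[]))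
    (HasDegree⇒≋̸[] (constant 1#) (HasDegree-constant 1≉0))
  ... | inj₂ (e , q-deg) = contradiction
    (HasDegree-unique (constant 1#) (HasDegree-constant 1≉0) (HasDegree-cong qf≋1 (HasDegree-* q f q-deg f-deg)))
    (ℕ.<⇒≢ (ℕ.≤-trans 0<d (ℕ.m≤n+m _ e)))
  reducible-if-∣-product {f} (g ∷ gs) f-deg 0<d ((m , m<d , g-deg) ∷ gs-deg) f∣
    with reducible-or-∣ (suc m) g _ m f-deg g-deg ℕ.≤-refl m<d f∣
  ... | inj₁ reducible = reducible
  ... | inj₂ f∣gs      = reducible-if-∣-product gs f-deg 0<d gs-deg f∣gs

-- Finite fields: pigeonhole principle, search and characteristic

Fin-injective⇒surjective : ∀ {n} (f : Fin n → Fin n) → Injective _≡_ _≡_ f → StrictlySurjective _≡_ f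
Fin-injective⇒surjective {suc n} f f-inj j with any? (λ i → f i Fin.≟ j)
... | yes hit = hit
... | no miss = contradiction (Fin.injective⇒≤ avoid-inj) (ℕ.n≮n n)
  where
  j≢f : ∀ i → ¬ (j ≡ f i)
  j≢f i eq = miss (i , ≡.sym eq)
  avoid : Fin (suc n) → Fin n
  avoid i = punchOut (j≢f i)
  avoid-inj : Injective _≡_ _≡_ avoid
  avoid-inj {i} {k} eq = f-inj (punchOut-injective (j≢f i) (j≢f k) eq)

module FiniteFieldProperties {c ℓ₁ ℓ₂ : Level} {q : ℕ} (F : FiniteField c ℓ₁ ℓ₂ q) where

  open FiniteField F using (commutativeRing; enumeration; _#_; #⇒invertible; invertible⇒#; #-irrefl; tight)
  open CommutativeRing commutativeRing
  open Inverse enumeration using (to; from; to-cong; strictlyInverseˡ; strictlyInverseʳ)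
  open import Algebra.Properties.Ring ring
  open import Algebra.Properties.Monoid.Sum +-monoid using (sum; sum-cong-≋; sum-replicate)
  open import Algebra.Properties.CommutativeMonoid.Sum +-commutativeMonoid using (sum-permute; ∑-distrib-+)
  open import Algebra.Properties.Semiring.Mult semiring using (_×_; ×1-homo-*; ×-homo-1)
  open import Relation.Binary.Reasoning.Setoid setoid

  to-injective : ∀ {x y} → to x ≡ to y → x ≈ y
  to-injective {x} {y} eq = trans (sym (strictlyInverseʳ x)) (trans (reflexive (≡.cong from eq)) (strictlyInverseʳ y))

  infix 4 _≈?_
  _≈?_ : ∀ x y → Dec (x ≈ y)
  x ≈? y = Dec.map′ to-injective to-cong (to x Fin.≟ to y)

  search : ∀ {ℓ} (Q : Carrier → Set ℓ) → (∀ {x y} → x ≈ y → Q x → Q y) → (∀ x → Dec (Q x)) → Dec (∃[ x ] Q x)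
  search Q Q-resp Q? = Dec.map′
    (λ where (i , Qi) → from i , Qi)
    (λ where (x , Qx) → to x , Q-resp (sym (strictlyInverseʳ x)) Qx)
    (any? (Q? ∘ from))

  preimage? : ∀ {f : Carrier → Carrier} → (∀ {x y} → x ≈ y → f x ≈ f y) → ∀ y → Dec (∃[ x ] f x ≈ y)
  preimage? {f} f-cong y = search (λ x → f x ≈ y) (λ x≈x′ → trans (f-cong (sym x≈x′))) (λ x → f x ≈? y)

  injective⇒surjective : ∀ {f : Carrier → Carrier} → (∀ {x y} → x ≈ y → f x ≈ f y) →
                         (∀ {x y} → f x ≈ f y → x ≈ y) → ∀ y → ∃[ x ] f x ≈ y
  injective⇒surjective {f} f-cong f-inj y
    with Fin-injective⇒surjective (to ∘ f ∘ from)
      (λ {i} {j} eq → from-injective i j (to-cong (f-inj (to-injective eq)))) (to y)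
    where
    from-injective : ∀ i j → to (from i) ≡ to (from j) → i ≡ j
    from-injective i j eq = ≡.trans (≡.sym (strictlyInverseˡ i)) (≡.trans eq (strictlyInverseˡ j))
  ... | i , fi≡y = from i , to-injective fi≡y

  -- A choice of preimages; it respects _≈_ because it is made on indices.
  weak-inverse : ∀ {f : Carrier → Carrier} → (∀ {x y} → x ≈ y → f x ≈ f y) →
                 ∃[ g ] ((∀ {x y} → x ≈ y → g x ≈ g y) ∧ (∀ x → f (g (f x)) ≈ f x))
  weak-inverse {f} f-cong = from ∘ choose ∘ to ,
    (λ x≈y → reflexive (≡.cong (from ∘ choose) (to-cong x≈y))) ,
    (λ x → choose-preimage x (any? (λ i → to (f (from i)) Fin.≟ to (f x))) ≡.refl)
    where
    choice : ∀ j → Dec (∃[ i ] to (f (from i)) ≡ j) → Fin q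
    choice j (yes (i , _)) = i
    -- An arbitrary default: nothing is promised about `g` outside the image of `f`.
    choice j (no _)        = j
    choose : Fin q → Fin q
    choose j = choice j (any? (λ i → to (f (from i)) Fin.≟ j))
    choose-preimage : ∀ x (d : Dec (∃[ i ] to (f (from i)) ≡ to (f x))) {j} → j ≡ choice (to (f x)) d → f (from j) ≈ f x
    choose-preimage x (yes (i , eq)) ≡.refl = to-injective eq
    choose-preimage x (no none)      _      =
      contradiction (to x , to-cong (f-cong (strictlyInverseʳ x))) none

  1≉0 : ¬ (1# ≈ 0#)
  1≉0 1≈0 = #-irrefl refl (invertible⇒# {0#} {0#} (0# , collapse , collapse))
    where
    collapse : ∀ {x} → x ≈ 1#
    collapse {x} = trans (sym (*-identityʳ x)) (trans (*-congˡ 1≈0) (trans (zeroʳ x) (sym 1≈0)))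

  -- An `x` without inverse is not apart from `0#`, hence equal to it by `tight`. This only refutes
  -- the absence of an inverse; searching the finite carrier turns the refutation into a witness.
  inverse : ∀ x → ¬ (x ≈ 0#) → ∃[ y ] y * x ≈ 1#
  inverse x x≉0 = decidable-stable (preimage? {_* x} *-congʳ 1#) λ none →
    x≉0 (proj₁ (tight x 0#) λ x#0 → none (invertible (#⇒invertible x#0)))
    where
    invertible : ∃[ y ] (y * (x - 0#) ≈ 1# ∧ (x - 0#) * y ≈ 1#) → ∃[ y ] y * x ≈ 1#
    invertible (y , y[x-0]≈1 , _) = y , trans (*-congˡ (sym (trans (+-congˡ -0#≈0#) (+-identityʳ x)))) y[x-0]≈1

  *-cancelˡ-≉0 : ∀ {x y} → ¬ (x ≈ 0#) → x * y ≈ 0# → y ≈ 0#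
  *-cancelˡ-≉0 {x} {y} x≉0 xy≈0 with inverse x x≉0
  ... | x⁻¹ , x⁻¹x≈1 = begin
    y              ≈⟨ *-identityˡ y ⟨
    1# * y         ≈⟨ *-congʳ x⁻¹x≈1 ⟨
    (x⁻¹ * x) * y  ≈⟨ *-assoc x⁻¹ x y ⟩
    x⁻¹ * (x * y)  ≈⟨ *-congˡ xy≈0 ⟩
    x⁻¹ * 0#       ≈⟨ zeroʳ x⁻¹ ⟩
    0#             ∎

  -- Translation by 1# permutes the field, so Σ x ≈ Σ (x + 1#) ≈ Σ x + q × 1#.
  q×1≈0 : q × 1# ≈ 0#
  q×1≈0 = +-identityʳ-unique (sum from) (q × 1#) (begin
    sum from + q × 1#                    ≈⟨ +-congˡ (sum-replicate q) ⟨
    sum from + sum {q} (λ _ → 1#)        ≈⟨ ∑-distrib-+ from (λ _ → 1#) ⟨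
    sum (λ i → from i + 1#)              ≈⟨ sum-cong-≋ (λ i → strictlyInverseʳ (from i + 1#)) ⟨
    sum (λ i → from (to (from i + 1#)))  ≈⟨ sum-permute from translation ⟨
    sum from                             ∎)
    where
    translate-back : ∀ x y → x + y ≈ 0# → ∀ i → to (from (to (from i + x)) + y) ≡ i
    translate-back x y x+y≈0 i = ≡.trans (to-cong (begin
      from (to (from i + x)) + y   ≈⟨ +-congʳ (strictlyInverseʳ _) ⟩
      (from i + x) + y             ≈⟨ +-assoc _ _ _ ⟩
      from i + (x + y)             ≈⟨ +-congˡ x+y≈0 ⟩
      from i + 0#                  ≈⟨ +-identityʳ _ ⟩
      from i                       ∎)) (strictlyInverseˡ i)
    translation : Permutation′ q
    translation = permutation (λ i → to (from i + 1#)) (λ i → to (from i - 1#))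
      (translate-back (- 1#) 1# (-‿inverseˡ 1#)) (translate-back 1# (- 1#) (-‿inverseʳ 1#))

  -- If `p × 1#` were nonzero, it could be cancelled `s` times from `(p ^ s) × 1# ≈ 0#`, leaving
  -- `1# ≈ 0#`.
  characteristic : ∀ {p} s → q ≡ p ℕ.^ s → p × 1# ≈ 0#
  characteristic {p} s q≡p^s = decidable-stable (p × 1# ≈? 0#) λ p×1≉0 →
    power≉0 p×1≉0 s (trans (reflexive (≡.cong (_× 1#) (≡.sym q≡p^s))) q×1≈0)
    where
    power≉0 : ¬ (p × 1# ≈ 0#) → ∀ s → ¬ ((p ℕ.^ s) × 1# ≈ 0#)
    power≉0 p×1≉0 zero    eq = 1≉0 (trans (sym (×-homo-1 1#)) eq)
    power≉0 p×1≉0 (suc s) eq = power≉0 p×1≉0 s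
      (*-cancelˡ-≉0 p×1≉0 (trans (sym (×1-homo-* p (p ℕ.^ s))) eq))

  isDiscreteField : IsDiscreteField commutativeRing
  isDiscreteField = record { 1≉0 = 1≉0 ; ≈0? = _≈? 0# ; inverse = inverse }

-- The Artin-Schreier map and the coefficients of v

module ArtinSchreier {c ℓ₁ ℓ₂ : Level} {p s : ℕ} (p-prime : Prime p) (F : FiniteField c ℓ₁ ℓ₂ (p ℕ.^ s)) where

  open FiniteField F using (commutativeRing)
  open CommutativeRing commutativeRing
  open FiniteFieldProperties F
  open import Algebra.Properties.Ring ring
  open import Algebra.Properties.Semiring.Mult semiring using (_×_; ×-homo-+)
  open import Algebra.Properties.CommutativeSemiring.Exp commutativeSemiring using (_^_; ^-congˡ; ^-distrib-*)
  open import Relation.Binary.Reasoning.Setoid setoid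
  open RingSolver commutativeRing

  char-p : p × 1# ≈ 0#
  char-p = characteristic s ≡.refl

  open Frobenius commutativeRing p-prime char-p

  -- The Artin-Schreier map. Its kernel is the prime field `𝔽ₚ`, which is never formed as a set:
  -- `k ^ p ≈ k` expresses membership in it.
  ℘ : Carrier → Carrier
  ℘ u = u ^ p - u

  ℘-cong : ∀ {u v} → u ≈ v → ℘ u ≈ ℘ v
  ℘-cong u≈v = +-cong (^-congˡ p u≈v) (-‿cong u≈v)

  ℘-distrib-+ : ∀ u v → ℘ (u + v) ≈ ℘ u + ℘ v
  ℘-distrib-+ u v = trans (+-congʳ (^p-distrib-+ u v))
    (solve 4 (λ uᵖ vᵖ u v → uᵖ :+ vᵖ :- (u :+ v) := (uᵖ :- u) :+ (vᵖ :- v)) refl (u ^ p) (v ^ p) u v)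

  ℘-distrib-- : ∀ u v → ℘ (u - v) ≈ ℘ u - ℘ v
  ℘-distrib-- u v = trans (+-congʳ (^p-distrib-- u v))
    (solve 4 (λ uᵖ vᵖ u v → uᵖ :- vᵖ :- (u :- v) := (uᵖ :- u) :- (vᵖ :- v)) refl (u ^ p) (v ^ p) u v)

  ℘-shift : ∀ t {u j} → j ^ p ≈ j → t + ℘ u ≈ 0# → t + ℘ (u + j) ≈ 0#
  ℘-shift t {u} {j} jᵖ≈j eq = trans (+-congˡ (trans (℘-distrib-+ u j)
    (trans (+-congˡ (x≈y⇒x∙y⁻¹≈ε jᵖ≈j)) (+-identityʳ _)))) eq

  -- The shift by `j` that `℘` does not see in `℘-shift` contributes `j * e` here, because `jᵖ = j`.
  -- So the second equation can be repaired without spoiling the first.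
  ^p-shift : ∀ t e w {u j} → j ^ p ≈ j → t + u ^ p * e + j * e + w ≈ 0# → t + (u + j) ^ p * e + w ≈ 0#
  ^p-shift t e w {u} {j} jᵖ≈j eq = begin
    t + (u + j) ^ p * e + w        ≈⟨ +-congʳ (+-congˡ (*-congʳ (trans (^p-distrib-+ u j) (+-congˡ jᵖ≈j)))) ⟩
    t + (u ^ p + j) * e + w
      ≈⟨ solve 5 (λ t uᵖ j e w →
           t :+ (uᵖ :+ j) :* e :+ w
           := t :+ uᵖ :* e :+ j :* e :+ w)
           refl t (u ^ p) j e w ⟩
    t + u ^ p * e + j * e + w      ≈⟨ eq ⟩
    0#                             ∎

  1^n≈1 : ∀ n → 1# ^ n ≈ 1#
  1^n≈1 zero    = refl
  1^n≈1 (suc n) = trans (*-identityˡ _) (1^n≈1 n)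

  ^p-fixed-inverse : ∀ {j} i → i * j ≈ 1# → j ^ p ≈ j → i ^ p ≈ i
  ^p-fixed-inverse {j} i ij≈1 jᵖ≈j = begin
    i ^ p             ≈⟨ *-identityˡ _ ⟨
    1# * i ^ p        ≈⟨ *-congʳ ij≈1 ⟨
    (i * j) * i ^ p   ≈⟨ solve 3 (λ i j iᵖ → i :* j :* iᵖ := i :* (iᵖ :* j)) refl i j (i ^ p) ⟩
    i * (i ^ p * j)   ≈⟨ *-congˡ (*-congˡ (sym jᵖ≈j)) ⟩
    i * (i ^ p * j ^ p) ≈⟨ *-congˡ (sym (^-distrib-* i j p)) ⟩
    i * (i * j) ^ p   ≈⟨ *-congˡ (trans (^-congˡ p ij≈1) (1^n≈1 p)) ⟩
    i * 1#            ≈⟨ *-identityʳ i ⟩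
    i                 ∎

  ℘-homogeneous : ∀ {i} u → i ^ p ≈ i → ℘ (i * u) ≈ i * ℘ u
  ℘-homogeneous {i} u iᵖ≈i = trans (+-congʳ (trans (^-distrib-* i u p) (*-congʳ iᵖ≈i)))
    (sym (x[y-z]≈xy-xz i (u ^ p) u))

  -- The image of ℘ has index p.  Writing σ for a choice of preimages under ℘, the map
  -- x ↦ (x - σ (℘ x)) e + ℘ x is injective, because x - σ (℘ x) lies in 𝔽ₚ = ker ℘ and
  -- 𝔽ₚ e meets the image of ℘ only in 0; being an injection of a finite set, it is onto.
  opaque
    image-℘-index : ∀ {e} → ¬ (∃[ u ] e + ℘ u ≈ 0#) →
                    ∀ z → ∃[ k ] ∃[ u ] (k ^ p ≈ k ∧ z + k * e + ℘ u ≈ 0#)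
    image-℘-index {e} e∉℘ z with weak-inverse {℘} ℘-cong
    ... | σ , σ-cong , ℘σ℘≈℘ with injective⇒surjective {λ x → (x - σ (℘ x)) * e + ℘ x}
      (λ x≈y → +-cong (*-congʳ (+-cong x≈y (-‿cong (σ-cong (℘-cong x≈y))))) (℘-cong x≈y)) inj (- z)
      where
      κ : Carrier → Carrier
      κ x = x - σ (℘ x)
      κ-fixed : ∀ x → κ x ^ p ≈ κ x
      κ-fixed x = x∙y⁻¹≈ε⇒x≈y _ _ (trans (℘-distrib-- x (σ (℘ x)))
        (trans (+-congˡ (-‿cong (℘σ℘≈℘ x))) (-‿inverseʳ (℘ x))))
      inj : ∀ {x y} → κ x * e + ℘ x ≈ κ y * e + ℘ y → x ≈ y
      inj {x} {y} eq with (κ x - κ y) ≈? 0#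
      ... | no κx≉κy with inverse (κ x - κ y) κx≉κy
      -- By `eq`, `(κ x - κ y) e + ℘ (x - y)` vanishes. The inverse `i` of `κ x - κ y` lies in `𝔽ₚ`,
      -- so multiplication by it passes inside `℘` and leaves `e + ℘ (i (x - y)) = 0`.
      ...   | i , ij≈1 = contradiction (i * (x - y) , (begin
        e + ℘ (i * (x - y))
          ≈⟨ +-cong (trans (sym (*-identityˡ e)) (*-congʳ (sym ij≈1)))
             (trans (℘-homogeneous (x - y) iᵖ≈i) (*-congˡ (℘-distrib-- x y))) ⟩
        i * (κ x - κ y) * e + i * (℘ x - ℘ y)
          ≈⟨ solve 6 (λ i k l e u v →
               i :* (k :- l) :* e :+ i :* (u :- v)
               := i :* ((k :* e :+ u) :- (l :* e :+ v)))
               refl i (κ x) (κ y) e (℘ x) (℘ y) ⟩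
        i * ((κ x * e + ℘ x) - (κ y * e + ℘ y))
          ≈⟨ *-congˡ (x≈y⇒x∙y⁻¹≈ε eq) ⟩
        i * 0#
          ≈⟨ zeroʳ i ⟩
        0# ∎)) e∉℘
        where
        iᵖ≈i : i ^ p ≈ i
        iᵖ≈i = ^p-fixed-inverse i ij≈1 (trans (^p-distrib-- (κ x) (κ y)) (+-cong (κ-fixed x) (-‿cong (κ-fixed y))))
      inj {x} {y} eq | yes κx-κy≈0 = begin
        x                  ≈⟨ solve 2 (λ x s → x := (x :- s) :+ s) refl x (σ (℘ x)) ⟩
        κ x + σ (℘ x)      ≈⟨ +-cong κx≈κy (σ-cong ℘x≈℘y) ⟩
        κ y + σ (℘ y)      ≈⟨ solve 2 (λ x s → (x :- s) :+ s := x) refl y (σ (℘ y)) ⟩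
        y                  ∎
        where
        κx≈κy : κ x ≈ κ y
        κx≈κy = x∙y⁻¹≈ε⇒x≈y _ _ κx-κy≈0
        ℘x≈℘y : ℘ x ≈ ℘ y
        ℘x≈℘y = +-cancelˡ (κ y * e) _ _ (trans (+-congʳ (*-congʳ (sym κx≈κy))) eq)
    ... | x , Ψx≈-z = x - σ (℘ x) , x ,
      x∙y⁻¹≈ε⇒x≈y _ _ (trans (℘-distrib-- x (σ (℘ x))) (trans (+-congˡ (-‿cong (℘σ℘≈℘ x))) (-‿inverseʳ (℘ x)))) ,
      trans (+-assoc z _ _) (trans (+-congˡ Ψx≈-z) (-‿inverseʳ z))

  Root : Carrier → Carrier → Carrier → Set _
  Root a b c = ∃[ r ] a * r ^ p - b * r ≈ c

  KernelElement : Carrier → Carrier → Set _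
  KernelElement a b = ∃[ d ] (¬ (d ≈ 0#) ∧ a * d ^ p ≈ b * d)

  -- A map of a finite set that misses `c` is not injective, and by additivity the difference of two
  -- points with equal values lies in the kernel. Both the root and the kernel element are found by
  -- search.
  root-or-kernel : ∀ a b c → Root a b c ⊎ (¬ Root a b c ∧ KernelElement a b)
  root-or-kernel a b c with preimage? L-cong c
    where
    L-cong : ∀ {x y} → x ≈ y → a * x ^ p - b * x ≈ a * y ^ p - b * y
    L-cong x≈y = +-cong (*-congˡ (^-congˡ p x≈y)) (-‿cong (*-congˡ x≈y))
  ... | yes root = inj₁ root
  ... | no ¬root with search (λ d → ¬ (d ≈ 0#) ∧ a * d ^ p ≈ b * d)
    (λ d≈d′ → λ where (d≉0 , eq) → d≉0 ∘ trans d≈d′ , trans (*-congˡ (^-congˡ p (sym d≈d′))) (trans eq (*-congˡ d≈d′)))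
    (λ d → ¬? (d ≈? 0#) ×-dec (a * d ^ p ≈? b * d))
  ...   | yes kernel = inj₂ (¬root , kernel)
  ...   | no trivial = contradiction (injective⇒surjective
    (λ x≈y → +-cong (*-congˡ (^-congˡ p x≈y)) (-‿cong (*-congˡ x≈y))) L-inj c) ¬root
    where
    L-inj : ∀ {x y} → a * x ^ p - b * x ≈ a * y ^ p - b * y → x ≈ y
    L-inj {x} {y} eq = x∙y⁻¹≈ε⇒x≈y _ _ (decidable-stable (x - y ≈? 0#) λ x-y≉0 →
      trivial (x - y , x-y≉0 , x∙y⁻¹≈ε⇒x≈y _ _ (begin
      a * (x - y) ^ p - b * (x - y)       ≈⟨ +-congʳ (*-congˡ (^p-distrib-- x y)) ⟩
      a * (x ^ p - y ^ p) - b * (x - y)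
        ≈⟨ solve 6 (λ a b x y xᵖ yᵖ →
             a :* (xᵖ :- yᵖ) :- b :* (x :- y)
             := (a :* xᵖ :- b :* x) :- (a :* yᵖ :- b :* y))
             refl a b x y (x ^ p) (y ^ p) ⟩
      (a * x ^ p - b * x) - (a * y ^ p - b * y) ≈⟨ x≈y⇒x∙y⁻¹≈ε eq ⟩
      0#                                  ∎)))

  -- Substituting d x for x, where a dᵖ ≈ b d, turns a xᵖ - b x - c into b d (℘ x - c / (b d)).
  module _ {a b d b⁻¹ d⁻¹ : Carrier} (b⁻¹b≈1 : b⁻¹ * b ≈ 1#) (d⁻¹d≈1 : d⁻¹ * d ≈ 1#) (adᵖ≈bd : a * d ^ p ≈ b * d) where

    d⁻¹ᵖ≈ : d⁻¹ ^ p ≈ b⁻¹ * d⁻¹ * a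
    d⁻¹ᵖ≈ = begin
      d⁻¹ ^ p
        ≈⟨ trans (*-cong b⁻¹b≈1 (*-congʳ d⁻¹d≈1)) (trans (*-identityˡ _) (*-identityˡ _)) ⟨
      b⁻¹ * b * (d⁻¹ * d * d⁻¹ ^ p)
        ≈⟨ solve 5 (λ b b′ d d′ d′ᵖ →
             b′ :* b :* (d′ :* d :* d′ᵖ)
             := b′ :* d′ :* (b :* d) :* d′ᵖ)
             refl b b⁻¹ d d⁻¹ (d⁻¹ ^ p) ⟩
      b⁻¹ * d⁻¹ * (b * d) * d⁻¹ ^ p               ≈⟨ *-congʳ (*-congˡ adᵖ≈bd) ⟨
      b⁻¹ * d⁻¹ * (a * d ^ p) * d⁻¹ ^ p
        ≈⟨ solve 4 (λ k a u v →
             k :* (a :* u) :* v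
             := k :* a :* (v :* u))
             refl (b⁻¹ * d⁻¹) a (d ^ p) (d⁻¹ ^ p) ⟩
      b⁻¹ * d⁻¹ * a * (d⁻¹ ^ p * d ^ p)
        ≈⟨ *-congˡ (trans (sym (^-distrib-* d⁻¹ d p)) (trans (^-congˡ p d⁻¹d≈1) (1^n≈1 p))) ⟩
      b⁻¹ * d⁻¹ * a * 1#                          ≈⟨ *-identityʳ _ ⟩
      b⁻¹ * d⁻¹ * a                               ∎

    c/bd∉℘ : ∀ {c} → ¬ Root a b c → ¬ (∃[ u ] b⁻¹ * d⁻¹ * c + ℘ u ≈ 0#)
    -- With `L x = a xᵖ - b x` and `℘ u = - c / (b d)`, `L (- d u) = - b d ℘ u = c`.
    c/bd∉℘ {c} ¬root (u , eq) = ¬root (d * (- u) , (begin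
      a * (d * (- u)) ^ p - b * (d * (- u))
        ≈⟨ +-congʳ (*-congˡ (trans (^-distrib-* d (- u) p) (*-congˡ (^p-‿homo u)))) ⟩
      a * (d ^ p * - (u ^ p)) - b * (d * (- u))
        ≈⟨ solve 6 (λ a b d dᵖ u uᵖ →
             a :* (dᵖ :* (:- uᵖ)) :- b :* (d :* (:- u))
             := (a :* dᵖ) :* (:- uᵖ) :+ b :* d :* u)
             refl a b d (d ^ p) u (u ^ p) ⟩
      (a * d ^ p) * - (u ^ p) + b * d * u
        ≈⟨ +-congʳ (*-congʳ adᵖ≈bd) ⟩
      b * d * - (u ^ p) + b * d * u
        ≈⟨ solve 7 (λ b b′ c d d′ u uᵖ →
             b :* d :* (:- uᵖ) :+ b :* d :* u
             := (b′ :* b) :* (d′ :* d) :* c :- b :* d :* (b′ :* d′ :* c :+ (uᵖ :- u)))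
             refl b b⁻¹ c d d⁻¹ u (u ^ p) ⟩
      (b⁻¹ * b) * (d⁻¹ * d) * c - b * d * (b⁻¹ * d⁻¹ * c + ℘ u)
        ≈⟨ +-cong (*-congʳ (*-cong b⁻¹b≈1 d⁻¹d≈1)) (-‿cong (*-congˡ eq)) ⟩
      1# * 1# * c - b * d * 0#
        ≈⟨ +-cong (trans (*-congʳ (*-identityˡ 1#)) (*-identityˡ c)) (trans (-‿cong (zeroʳ _)) -0#≈0#) ⟩
      c + 0#
        ≈⟨ +-identityʳ c ⟩
      c ∎))

  -- The coefficients of v in the lemmas quadratic, linear and bilinear below.  The first equation
  -- in u (or t) leaves it free up to 𝔽ₚ; shifting it by j ∈ 𝔽ₚ adds j e (or j b) to the
  -- next equation, which makes that one solvable in turn.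
  QuadraticParameters LinearParameters BilinearParameters : Carrier → Carrier → Set _
  QuadraticParameters b e = ∃[ k ] ∃[ u ] ∃[ w ]
    (k ^ p ≈ k ∧ b + (k + k) * e + ℘ u ≈ 0# ∧ e + k * (e * e) + u ^ p * e + ℘ w ≈ 0#)
  LinearParameters b e = ∃[ u ] ∃[ w ] (b + ℘ u ≈ 0# ∧ e + u ^ p * e + ℘ w ≈ 0#)
  BilinearParameters b e = ∃[ k ] ∃[ t ] ∃[ u ] ∃[ w ]
    (k ^ p ≈ k ∧ b + k * e + ℘ t ≈ 0# ∧
     k * (b + e + b * e) + t ^ p * b + ℘ u ≈ 0# ∧
     e + k * (b * e + e * e) + t ^ p * e + u ^ p * e + ℘ w ≈ 0#)

  module _ {e : Carrier} (e∉℘ : ¬ (∃[ u ] e + ℘ u ≈ 0#)) where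

    2≉0 : ∀ {m} → p ≡ suc (m ℕ.+ m) → ¬ (1# + 1# ≈ 0#)
    2≉0 {m} p≡1+2m 2≈0 = 1≉0 (begin
      1#                       ≈⟨ +-identityʳ 1# ⟨
      1# + 0#                  ≈⟨ +-congˡ (m+m×1≈0 m) ⟨
      suc (m ℕ.+ m) × 1#       ≡⟨ ≡.cong (_× 1#) p≡1+2m ⟨
      p × 1#                   ≈⟨ char-p ⟩
      0#                       ∎)
      where
      m+m×1≈0 : ∀ m → (m ℕ.+ m) × 1# ≈ 0#
      m+m×1≈0 m = begin
        (m ℕ.+ m) × 1#           ≈⟨ ×-homo-+ 1# m m ⟩
        m × 1# + m × 1#          ≈⟨ +-cong (*-identityʳ (m × 1#)) (*-identityʳ (m × 1#)) ⟨
        m × 1# * 1# + m × 1# * 1# ≈⟨ distribˡ (m × 1#) 1# 1# ⟨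
        m × 1# * (1# + 1#)       ≈⟨ *-congˡ 2≈0 ⟩
        m × 1# * 0#              ≈⟨ zeroʳ (m × 1#) ⟩
        0#                       ∎

    parameters-odd : ∀ {m} → p ≡ suc (m ℕ.+ m) → ∀ b →
      QuadraticParameters b e
    parameters-odd {m} p≡1+2m b =
      let ½ , ½*2≈1 = inverse (1# + 1#) (2≉0 {m} p≡1+2m)
          l , u , lᵖ≈l , b+le+℘u≈0 = image-℘-index e∉℘ b
          -- The cross term of `k y²` carries `k + k`, while `image-℘-index` provides `l`. Halving
          -- stays inside `𝔽ₚ`, as `1# + 1#` and hence `½` belong to it.
          k = ½ * l
          j , w , jᵖ≈j , eq = image-℘-index e∉℘ (e + k * (e * e) + u ^ p * e)
          ½ᵖ≈½ = ^p-fixed-inverse ½ ½*2≈1 (trans (^p-distrib-+ 1# 1#) (+-cong (1^n≈1 p) (1^n≈1 p)))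
          k+k≈l = begin
            k + k                  ≈⟨ +-cong (*-identityˡ k) (*-identityˡ k) ⟨
            1# * k + 1# * k        ≈⟨ distribʳ k 1# 1# ⟨
            (1# + 1#) * k          ≈⟨ *-assoc (1# + 1#) ½ l ⟨
            (1# + 1#) * ½ * l      ≈⟨ *-congʳ (trans (*-comm (1# + 1#) ½) ½*2≈1) ⟩
            1# * l                 ≈⟨ *-identityˡ l ⟩
            l                      ∎
      in k , u + j , w ,
         trans (^-distrib-* ½ l p) (*-cong ½ᵖ≈½ lᵖ≈l) ,
         ℘-shift (b + (k + k) * e) jᵖ≈j (trans (+-congʳ (+-congˡ (*-congʳ k+k≈l))) b+le+℘u≈0) ,
         ^p-shift (e + k * (e * e)) e (℘ w) jᵖ≈j eq

    -- In the bilinear system a shift of `t` by `j` in `𝔽ₚ` moves the third equation by `j b`, which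
    -- makes it solvable when `b` is outside the image of `℘`. When `b` is inside, the linear system
    -- asks for no correction: its first equation is solvable as it stands.
    parameters-even : ∀ b → LinearParameters b e ⊎ BilinearParameters b e
    parameters-even b = by-cases
      (search (λ u → b + ℘ u ≈ 0#) (λ u≈v → trans (+-congˡ (℘-cong (sym u≈v)))) (λ u → b + ℘ u ≈? 0#))
      where
      by-cases : Dec (∃[ u ] b + ℘ u ≈ 0#) → LinearParameters b e ⊎ BilinearParameters b e
      by-cases (yes (u , b+℘u≈0)) =
        let j , w , jᵖ≈j , eq = image-℘-index e∉℘ (e + u ^ p * e)
        in inj₁ (u + j , w , ℘-shift b jᵖ≈j b+℘u≈0 , ^p-shift e e (℘ w) jᵖ≈j eq)
      by-cases (no b∉℘) =
        let k , u , kᵖ≈k , b+ke+℘u≈0 = image-℘-index e∉℘ b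
            j , v , jᵖ≈j , eqᵥ = image-℘-index b∉℘ (k * (b + e + b * e) + u ^ p * b)
            i , w , iᵖ≈i , eq = image-℘-index e∉℘ (e + k * (b * e + e * e) + (u + j) ^ p * e + v ^ p * e)
        in inj₂ (k , u + j , v + i , w , kᵖ≈k ,
             ℘-shift (b + k * e) jᵖ≈j b+ke+℘u≈0 ,
             ℘-shift (k * (b + e + b * e) + (u + j) ^ p * b) iᵖ≈i (^p-shift (k * (b + e + b * e)) b (℘ v) jᵖ≈j eqᵥ) ,
             ^p-shift (e + k * (b * e + e * e) + (u + j) ^ p * e) e (℘ w) iᵖ≈i eq)

-- Combinations of iterates fixed by the p-th power map modulo π

module AlmostInvariants {c ℓ : Level} (R : CommutativeRing c ℓ)
  {p : ℕ} (p-prime : Prime p) (char-p : Annihilates p R) where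

  open CommutativeRing R
  open import Algebra.Properties.CommutativeSemiring.Exp commutativeSemiring using (_^_; ^-distrib-*)
  open import Algebra.Properties.Semiring.Divisibility semiring using (_∣_; _,_)
  open import Relation.Binary.Reasoning.Setoid setoid
  open RingSolver R
  open Frobenius R p-prime char-p

  private
    *≈0 : ∀ {x} y → x ≈ 0# → x * y ≈ 0#
    *≈0 y x≈0 = trans (*-congʳ x≈0) (zeroˡ y)


  ^p-combination : ∀ k x y → (x + k * y) ^ p ≈ x ^ p + k ^ p * y ^ p
  ^p-combination k x y = trans (^p-distrib-+ x (k * y)) (+-congˡ (^-distrib-* k y p))

  -- Modulo `π`, the terms in `x` and `y²` of `vᵖ - v` cancel because 1 and `k` lie in `𝔽ₚ`. The
  -- last two hypotheses say that the coefficient of `y` and the constant term vanish as well.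
  quadratic : ∀ {x y b e k u w π} →
    x ^ p ≈ x + b * y + e → y ^ p ≈ y + π + e → k ^ p ≈ k →
    b + (k + k) * e + (u ^ p - u) ≈ 0# → e + k * (e * e) + u ^ p * e + (w ^ p - w) ≈ 0# →
    let v = x + u * y + k * (y * y) + w in π ∣ v ^ p - v
  quadratic {x} {y} {b} {e} {k} {u} {w} {π} xᵖ yᵖ kᵖ linear constant =
    -- What `π` multiplies: `uᵖ π` comes from `u y`, and `k ((y + e + π)² - (y + e)²)` from `k y²`.
    u ^ p + (k + k) * (y + e) + k * π , sym (begin
    (x + u * y + k * (y * y) + w) ^ p - (x + u * y + k * (y * y) + w)
      ≈⟨ +-congʳ expand ⟩
    ((x + b * y + e) + u ^ p * (y + π + e) + k * ((y + π + e) * (y + π + e)) + w ^ p) - (x + u * y + k * (y * y) + w)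
      ≈⟨ solve 10 (λ x y b e k u uᵖ w wᵖ π →
           (x :+ b :* y :+ e) :+ uᵖ :* (y :+ π :+ e) :+ k :* ((y :+ π :+ e) :* (y :+ π :+ e)) :+ wᵖ
             :- (x :+ u :* y :+ k :* (y :* y) :+ w)
           := (b :+ (k :+ k) :* e :+ (uᵖ :- u)) :* y :+ (e :+ k :* (e :* e) :+ uᵖ :* e :+ (wᵖ :- w))
              :+ (uᵖ :+ (k :+ k) :* (y :+ e) :+ k :* π) :* π)
         refl x y b e k u (u ^ p) w (w ^ p) π ⟩
    (b + (k + k) * e + (u ^ p - u)) * y + (e + k * (e * e) + u ^ p * e + (w ^ p - w)) + (u ^ p + (k + k) * (y + e) + k * π) * π
      ≈⟨ +-congʳ (trans (+-cong (*≈0 y linear) constant) (+-identityˡ 0#)) ⟩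
    0# + (u ^ p + (k + k) * (y + e) + k * π) * π
      ≈⟨ +-identityˡ _ ⟩
    (u ^ p + (k + k) * (y + e) + k * π) * π ∎)
    where
    expand : (x + u * y + k * (y * y) + w) ^ p ≈ (x + b * y + e) + u ^ p * (y + π + e) + k * ((y + π + e) * (y + π + e)) + w ^ p
    expand = begin
      (x + u * y + k * (y * y) + w) ^ p
        ≈⟨ ^p-distrib-+ _ w ⟩
      (x + u * y + k * (y * y)) ^ p + w ^ p
        ≈⟨ +-congʳ (^p-combination k _ (y * y)) ⟩
      (x + u * y) ^ p + k ^ p * (y * y) ^ p + w ^ p
        ≈⟨ +-congʳ (+-cong (^p-combination u x y) (*-cong kᵖ (^-distrib-* y y p))) ⟩
      x ^ p + u ^ p * y ^ p + k * (y ^ p * y ^ p) + w ^ p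
        ≈⟨ +-congʳ (+-cong (+-cong xᵖ (*-congˡ yᵖ)) (*-congˡ (*-cong yᵖ yᵖ))) ⟩
      (x + b * y + e) + u ^ p * (y + π + e) + k * ((y + π + e) * (y + π + e)) + w ^ p ∎

  linear : ∀ {y z b e u w π} →
    y ^ p ≈ y + b * z + e → z ^ p ≈ z + π + e →
    b + (u ^ p - u) ≈ 0# → e + u ^ p * e + (w ^ p - w) ≈ 0# →
    let v = y + u * z + w in π ∣ v ^ p - v
  linear {y} {z} {b} {e} {u} {w} {π} yᵖ zᵖ linear constant = u ^ p , sym (begin
    (y + u * z + w) ^ p - (y + u * z + w)
      ≈⟨ +-congʳ expand ⟩
    (y + b * z + e) + u ^ p * (z + π + e) + w ^ p - (y + u * z + w)
      ≈⟨ solve 9 (λ y z b e u uᵖ w wᵖ π →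
           (y :+ b :* z :+ e) :+ uᵖ :* (z :+ π :+ e) :+ wᵖ :- (y :+ u :* z :+ w)
           := (b :+ (uᵖ :- u)) :* z :+ (e :+ uᵖ :* e :+ (wᵖ :- w)) :+ uᵖ :* π)
         refl y z b e u (u ^ p) w (w ^ p) π ⟩
    (b + (u ^ p - u)) * z + (e + u ^ p * e + (w ^ p - w)) + u ^ p * π
      ≈⟨ +-congʳ (trans (+-cong (*≈0 z linear) constant) (+-identityˡ 0#)) ⟩
    0# + u ^ p * π
      ≈⟨ +-identityˡ _ ⟩
    u ^ p * π ∎)
    where
    expand : (y + u * z + w) ^ p ≈ (y + b * z + e) + u ^ p * (z + π + e) + w ^ p
    expand = trans (^p-distrib-+ _ w) (+-congʳ (trans (^p-combination u y z) (+-cong yᵖ (*-congˡ zᵖ))))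

  -- `z ^ p ≈ z * z` is where `p = 2` enters. Up to multiples of `π`, the one quadratic term left in
  -- `vᵖ - v` is `k b z²`, caused by the `b z` in `yᵖ`. Replacing `z²` by `z + π + e` accounts for
  -- `k b` in the equation for `z`, for `k b e` in the constant one and for `k b` in the quotient.
  bilinear : ∀ {x y z b e k s u w π} → z ^ p ≈ z * z →
    x ^ p ≈ x + b * y + e → y ^ p ≈ y + b * z + e → z ^ p ≈ z + π + e → k ^ p ≈ k →
    b + k * e + (s ^ p - s) ≈ 0# → k * (b + e + b * e) + s ^ p * b + (u ^ p - u) ≈ 0# →
    e + k * (b * e + e * e) + s ^ p * e + u ^ p * e + (w ^ p - w) ≈ 0# →
    let v = x + s * y + u * z + k * (y * z) + w in π ∣ v ^ p - v
  bilinear {x} {y} {z} {b} {e} {k} {s} {u} {w} {π} z² xᵖ yᵖ zᵖ kᵖ linear-y linear-z constant =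
    k * (y + e + b * z) + k * b + u ^ p , sym (begin
    (x + s * y + u * z + k * (y * z) + w) ^ p - (x + s * y + u * z + k * (y * z) + w)
      ≈⟨ +-congʳ expand ⟩
    ((x + b * y + e) + s ^ p * (y + b * z + e) + u ^ p * (z + π + e) + k * ((y + b * z + e) * (z + π + e)) + w ^ p)
      - (x + s * y + u * z + k * (y * z) + w)
      ≈⟨ solve 13 (λ x y z b e k s sᵖ u uᵖ w wᵖ π →
           ((x :+ b :* y :+ e) :+ sᵖ :* (y :+ b :* z :+ e) :+ uᵖ :* (z :+ π :+ e) :+ k :* ((y :+ b :* z :+ e) :* (z :+ π :+ e)) :+ wᵖ)
             :- (x :+ s :* y :+ u :* z :+ k :* (y :* z) :+ w)
           := (b :+ k :* e :+ (sᵖ :- s)) :* y :+ (k :* (b :+ e :+ b :* e) :+ sᵖ :* b :+ (uᵖ :- u)) :* z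
              :+ (e :+ k :* (b :* e :+ e :* e) :+ sᵖ :* e :+ uᵖ :* e :+ (wᵖ :- w))
              :+ k :* b :* (z :* z :- (z :+ π :+ e))
              :+ (k :* (y :+ e :+ b :* z) :+ k :* b :+ uᵖ) :* π)
         refl x y z b e k s (s ^ p) u (u ^ p) w (w ^ p) π ⟩
    (b + k * e + (s ^ p - s)) * y + (k * (b + e + b * e) + s ^ p * b + (u ^ p - u)) * z
      + (e + k * (b * e + e * e) + s ^ p * e + u ^ p * e + (w ^ p - w))
      + k * b * (z * z - (z + π + e))
      + (k * (y + e + b * z) + k * b + u ^ p) * π
      ≈⟨ +-congʳ (trans (+-cong
           (trans (+-cong (trans (+-cong (*≈0 y linear-y) (*≈0 z linear-z)) (+-identityˡ 0#)) constant) (+-identityˡ 0#))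
           (trans (*-congˡ (trans (+-congʳ (trans (sym z²) zᵖ)) (-‿inverseʳ _))) (zeroʳ _))) (+-identityˡ 0#)) ⟩
    0# + (k * (y + e + b * z) + k * b + u ^ p) * π
      ≈⟨ +-identityˡ _ ⟩
    (k * (y + e + b * z) + k * b + u ^ p) * π ∎)
    where
    expand : (x + s * y + u * z + k * (y * z) + w) ^ p ≈
             (x + b * y + e) + s ^ p * (y + b * z + e) + u ^ p * (z + π + e) + k * ((y + b * z + e) * (z + π + e)) + w ^ p
    expand = begin
      (x + s * y + u * z + k * (y * z) + w) ^ p
        ≈⟨ ^p-distrib-+ _ w ⟩
      (x + s * y + u * z + k * (y * z)) ^ p + w ^ p
        ≈⟨ +-congʳ (^p-combination k _ (y * z)) ⟩
      (x + s * y + u * z) ^ p + k ^ p * (y * z) ^ p + w ^ p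
        ≈⟨ +-congʳ (+-cong (^p-combination u _ z) (*-cong kᵖ (^-distrib-* y z p))) ⟩
      (x + s * y) ^ p + u ^ p * z ^ p + k * (y ^ p * z ^ p) + w ^ p
        ≈⟨ +-congʳ (+-congʳ (+-congʳ (^p-combination s x y))) ⟩
      x ^ p + s ^ p * y ^ p + u ^ p * z ^ p + k * (y ^ p * z ^ p) + w ^ p
        ≈⟨ +-congʳ (+-cong (+-cong (+-cong xᵖ (*-congˡ yᵖ)) (*-congˡ zᵖ)) (*-congˡ (*-cong yᵖ zᵖ))) ⟩
      (x + b * y + e) + s ^ p * (y + b * z + e) + u ^ p * (z + π + e) + k * ((y + b * z + e) * (z + π + e)) + w ^ p ∎

-- Size and parity of p

prime≥2 : ∀ {p} → Prime p → 2 ≤ p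
prime≥2 {zero}        p-prime = contradiction p-prime ¬prime[0]
prime≥2 {suc zero}    p-prime = contradiction p-prime ¬prime[1]
prime≥2 {suc (suc p)} p-prime = s≤s (s≤s z≤n)

half : ∀ n → ∃[ m ] (n ≡ m ℕ.+ m ⊎ n ≡ suc (m ℕ.+ m))
half zero    = 0 , inj₁ ≡.refl
half (suc n) with half n
... | m , inj₁ n≡2m   = m , inj₂ (≡.cong suc n≡2m)
... | m , inj₂ n≡1+2m = suc m , inj₁ (≡.cong suc (≡.trans n≡1+2m (≡.sym (ℕ.+-suc m m))))

odd-prime : ∀ {p} → Prime p → 3 ≤ p → ∃[ m ] p ≡ suc (m ℕ.+ m)
odd-prime {p} p-prime 3≤p with half p
... | m , inj₂ p≡1+2m = m , p≡1+2m
... | m , inj₁ p≡2m with prime⇒irreducible p-prime (divides m (≡.trans p≡2m m+m≡m*2))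
  where
  m+m≡m*2 : m ℕ.+ m ≡ m ℕ.* 2
  m+m≡m*2 = ≡.trans (≡.cong (m ℕ.+_) (≡.sym (ℕ.+-identityʳ m))) (ℕ.*-comm 2 m)
...   | inj₁ ()
...   | inj₂ 2≡p = contradiction 3≤p (ℕ.<⇒≱ (ℕ.≤-reflexive (≡.cong suc (≡.sym 2≡p))))

-- The degree of `y z` against that of the third iterate, with the products left in the form in
-- which `f∘-degree` yields them.
2+4<8 : ∀ {p} → p ≡ 2 → p ℕ.* 1 ℕ.+ p ℕ.* (p ℕ.* 1) < p ℕ.* (p ℕ.* (p ℕ.* 1))
2+4<8 ≡.refl = ℕ.m≤m+n 7 1

-- Reducibility of the iterates

module Iteration {c ℓ₁ ℓ₂ : Level} {p s : ℕ} (p-prime : Prime p) (F : FiniteField c ℓ₁ ℓ₂ (p ℕ.^ s)) where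

  open FiniteField F using (commutativeRing)
  open CommutativeRing commutativeRing
  open FiniteFieldProperties F
  open ArtinSchreier {s = s} p-prime F
  open Polynomials commutativeRing
  open PolynomialRing commutativeRing
  open PolynomialDegree commutativeRing isDiscreteField
  open import Algebra.Properties.CommutativeSemiring.Exp commutativeSemiring using (_^_)
  open import Algebra.Properties.CommutativeSemiring.Exp P.commutativeSemiring
    using () renaming (_^_ to _^ₚ_; ^-congʳ to ^ₚ-congʳ; ^-distrib-* to ^ₚ-distrib-*; ^-homo-* to ^ₚ-homo-*)
  open import Algebra.Properties.Semiring.Mult P.semiring using () renaming (_×_ to _×ₚ_)
  open import Algebra.Properties.Semiring.Divisibility P.semiring using (_∣_; _,_; ∣ʳ-respʳ-≈; ∣ʳ-trans)
  open import Relation.Binary.Reasoning.Setoid P.setoid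
  open RingSolver polynomialRing

  char-p-polynomial : p ×ₚ constant 1# ≋ []
  char-p-polynomial = P.trans (P.sym (constant-×-homo p 1#)) (P.trans (constant-cong char-p) constant-0)

  open Frobenius polynomialRing p-prime char-p-polynomial
    using () renaming (^p-distrib-- to ^ₚp-distrib--)
  open AlmostInvariants polynomialRing p-prime char-p-polynomial

  private
    C : Carrier → Poly
    C = constant

  HasDegree-shift : ∀ f a {d} → HasDegree f d → 0 < d → HasDegree (f +ₚ constant a) d
  HasDegree-shift f a f-deg 0<d = HasDegree-+-lower f (constant a) f-deg
    (DegreeBelow-mono (constant a) 0<d (DegreeBelow-constant a))

  module _ {a b : Carrier} (a≉0 : ¬ (a ≈ 0#)) (b≉0 : ¬ (b ≈ 0#)) (c : Carrier) where

    f : Poly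
    f = monomial a p -ₚ monomial b 1 -ₚ constant c

    1≤p* : ∀ {n} → 1 ≤ n → 1 ≤ p ℕ.* n
    1≤p* 1≤n = ℕ.*-mono-≤ (ℕ.<⇒≤ (prime≥2 p-prime)) 1≤n

    f∘-degree : ∀ g {n} → HasDegree g n → 1 ≤ n → HasDegree (f ∘ₚ g) (p ℕ.* n)
    f∘-degree g g-deg 1≤n = HasDegree-cong (P.sym (∘ₚ-trinomial a b c p g))
      (HasDegree-trinomial g b c p a≉0 g-deg 1≤n (prime≥2 p-prime))

    reducible-if-root : ∀ {r} → a * r ^ p - b * r ≈ c → ∀ g {n} → HasDegree g n → 1 ≤ n → Reducible (f ∘ₚ g)
    reducible-if-root {r} root g {n} g-deg 1≤n = by-predecessor p ≡.refl
      where
      w = g -ₚ C r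
      w-deg : HasDegree w n
      w-deg = HasDegree-shift g (- r) g-deg 1≤n
      f∘g≋Lw : f ∘ₚ g ≋ C a *ₚ w ^ₚ p -ₚ C b *ₚ w
      f∘g≋Lw = begin
        f ∘ₚ g
          ≈⟨ ∘ₚ-trinomial a b c p g ⟩
        C a *ₚ g ^ₚ p -ₚ C b *ₚ g -ₚ C c
          ≈⟨ P.+-congˡ {C a *ₚ g ^ₚ p -ₚ C b *ₚ g} (P.-‿cong (constant-cong (sym root))) ⟩
        C a *ₚ g ^ₚ p -ₚ C b *ₚ g -ₚ (C (a * r ^ p) -ₚ C (b * r))
          ≈⟨ P.+-congˡ {C a *ₚ g ^ₚ p -ₚ C b *ₚ g} (P.-‿cong (P.+-cong
               (P.trans (constant-*-homo a (r ^ p)) (P.*-congˡ {C a} (constant-^-homo r p))) (P.-‿cong (constant-*-homo b r)))) ⟩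
        C a *ₚ g ^ₚ p -ₚ C b *ₚ g -ₚ (C a *ₚ C r ^ₚ p -ₚ C b *ₚ C r)
          ≈⟨ solve 6 (λ a b g gᵖ r rᵖ → a :* gᵖ :- b :* g :- (a :* rᵖ :- b :* r) := a :* (gᵖ :- rᵖ) :- b :* (g :- r))
               P.refl (C a) (C b) g (g ^ₚ p) (C r) (C r ^ₚ p) ⟩
        C a *ₚ (g ^ₚ p -ₚ C r ^ₚ p) -ₚ C b *ₚ w
          ≈⟨ P.+-congʳ { -ₚ (C b *ₚ w)} (P.*-congˡ {C a} (P.sym (^ₚp-distrib-- g (C r)))) ⟩
        C a *ₚ w ^ₚ p -ₚ C b *ₚ w ∎
      by-predecessor : ∀ k → p ≡ k → Reducible (f ∘ₚ g)
      by-predecessor zero          ≡.refl = contradiction p-prime ¬prime[0]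
      by-predecessor (suc zero)    ≡.refl = contradiction p-prime ¬prime[1]
      -- The factorization is `L w = w (a wᵏ - b)` with `k = p - 1`. As `k` is at least 1, the
      -- constant `b` stays below the leading term of the second factor.
      by-predecessor (suc k@(suc k′)) p≡1+k = reducible-if-∣-product (w ∷ (C a *ₚ w ^ₚ k -ₚ C b) ∷ [])
        (f∘-degree g g-deg 1≤n) (ℕ.≤-trans 1≤n (ℕ.<⇒≤ n<pn))
        ((n , n<pn , w-deg) ∷
         (k ℕ.* n , ≡.subst (λ p → k ℕ.* n < p ℕ.* n) (≡.sym p≡1+k) (ℕ.+-monoˡ-≤ (k ℕ.* n) 1≤n) ,
          HasDegree-shift (C a *ₚ w ^ₚ k) (- b)
            (HasDegree-* (C a) (w ^ₚ k) (HasDegree-constant a≉0) (HasDegree-^ w k w-deg))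
            (ℕ.≤-trans 1≤n (ℕ.m≤m+n n (k′ ℕ.* n)))) ∷ [])
        (constant 1# , (begin
          constant 1# *ₚ f ∘ₚ g                      ≈⟨ P.*-identityˡ (f ∘ₚ g) ⟩
          f ∘ₚ g                                     ≈⟨ f∘g≋Lw ⟩
          C a *ₚ w ^ₚ p -ₚ C b *ₚ w
            ≈⟨ P.+-congʳ { -ₚ (C b *ₚ w)} (P.*-congˡ {C a} (^ₚ-congʳ w p≡1+k)) ⟩
          C a *ₚ (w *ₚ w ^ₚ k) -ₚ C b *ₚ w
            ≈⟨ solve 4 (λ a b w wᵏ →
                 a :* (w :* wᵏ) :- b :* w
                 := w :* (a :* wᵏ :- b))
                 P.refl (C a) (C b) w (w ^ₚ k) ⟩
          w *ₚ (C a *ₚ w ^ₚ k -ₚ C b)                ≈⟨ P.*-congˡ {w} (P.*-identityʳ (C a *ₚ w ^ₚ k -ₚ C b)) ⟨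
          w *ₚ ((C a *ₚ w ^ₚ k -ₚ C b) *ₚ constant 1#) ∎))
        where
        n<pn : n < p ℕ.* n
        n<pn = ≡.subst (n <_) (ℕ.*-comm n p) (ℕ.m<m*n n p {{ℕ.>-nonZero 1≤n}} (prime≥2 p-prime))

    module NoRoot {b⁻¹ d⁻¹ d : Carrier} (b⁻¹b≈1 : b⁻¹ * b ≈ 1#) (d⁻¹d≈1 : d⁻¹ * d ≈ 1#)
      (adᵖ≈bd : a * d ^ p ≈ b * d) (¬root : ¬ Root a b c) where

      e : Carrier
      e = b⁻¹ * d⁻¹ * c

      e∉℘ : ¬ (∃[ u ] e + ℘ u ≈ 0#)
      e∉℘ = c/bd∉℘ b⁻¹b≈1 d⁻¹d≈1 adᵖ≈bd ¬root

      d⁻¹≉0 : ¬ (d⁻¹ ≈ 0#)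
      d⁻¹≉0 d⁻¹≈0 = 1≉0 (trans (sym d⁻¹d≈1) (trans (*-congʳ d⁻¹≈0) (zeroˡ d)))

      scale : Poly → Poly
      scale g = C d⁻¹ *ₚ g

      scale-degree : ∀ g {n} → HasDegree g n → HasDegree (scale g) n
      scale-degree g g-deg = HasDegree-* (C d⁻¹) g (HasDegree-constant d⁻¹≉0) g-deg

      -- As `d⁻¹ᵖ = b⁻¹ d⁻¹ a`, the left side is `b⁻¹ d⁻¹` times `a gᵖ`, and `a gᵖ` equals
      -- `f ∘ g + b g + c`.
      scale^p : ∀ g → scale g ^ₚ p ≋ scale g +ₚ C b⁻¹ *ₚ scale (f ∘ₚ g) +ₚ C e
      scale^p g = begin
        scale g ^ₚ p
          ≈⟨ ^ₚ-distrib-* (C d⁻¹) g p ⟩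
        C d⁻¹ ^ₚ p *ₚ g ^ₚ p
          ≈⟨ P.*-congʳ {g ^ₚ p} (P.trans (P.sym (constant-^-homo d⁻¹ p))
               (P.trans (constant-cong (d⁻¹ᵖ≈ b⁻¹b≈1 d⁻¹d≈1 adᵖ≈bd)) (product a))) ⟩
        C b⁻¹ *ₚ C d⁻¹ *ₚ C a *ₚ g ^ₚ p
          ≈⟨ solve 7 (λ a b b′ c d′ g gᵖ → b′ :* d′ :* a :* gᵖ
               := b′ :* b :* (d′ :* g) :+ b′ :* (d′ :* (a :* gᵖ :- b :* g :- c)) :+ b′ :* d′ :* c)
               P.refl (C a) (C b) (C b⁻¹) (C c) (C d⁻¹) g (g ^ₚ p) ⟩
        C b⁻¹ *ₚ C b *ₚ scale g +ₚ C b⁻¹ *ₚ scale (C a *ₚ g ^ₚ p -ₚ C b *ₚ g -ₚ C c) +ₚ C b⁻¹ *ₚ C d⁻¹ *ₚ C c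
          ≈⟨ P.+-cong (P.+-cong
               (P.trans
                 (P.*-congʳ {scale g} (P.trans (P.sym (constant-*-homo b⁻¹ b)) (constant-cong b⁻¹b≈1)))
                 (P.*-identityˡ (scale g)))
               (P.*-congˡ {C b⁻¹} (P.*-congˡ {C d⁻¹} (P.sym (∘ₚ-trinomial a b c p g)))))
               (P.sym (product c)) ⟩
        scale g +ₚ C b⁻¹ *ₚ scale (f ∘ₚ g) +ₚ C e ∎
        where
        product : ∀ t → C (b⁻¹ * d⁻¹ * t) ≋ C b⁻¹ *ₚ C d⁻¹ *ₚ C t
        product t = P.trans (constant-*-homo (b⁻¹ * d⁻¹) t) (P.*-congʳ {C t} (constant-*-homo b⁻¹ d⁻¹))

      ∣-scale : ∀ g {h} → C b⁻¹ *ₚ scale g ∣ h → g ∣ h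
      ∣-scale g = ∣ʳ-trans {g} (C b⁻¹ *ₚ C d⁻¹ , P.*-assoc (C b⁻¹) (C d⁻¹) g)

      -- The equations for the coefficients hold in the field but are needed between constant
      -- polynomials. Each of these combinators takes the translations of its subterms, so an
      -- equation is transported by following its syntax tree.
      C-* : ∀ u v {f g} → C u ≋ f → C v ≋ g → C (u * v) ≋ f *ₚ g
      C-* u v u≋f v≋g = P.trans (constant-*-homo u v) (P.*-cong u≋f v≋g)

      C-+ : ∀ u v {f g} → C u ≋ f → C v ≋ g → C (u + v) ≋ f +ₚ g
      C-+ u v u≋f v≋g = P.+-cong {C u} {_} {C v} u≋f v≋g

      C-℘ : ∀ u → C (℘ u) ≋ C u ^ₚ p -ₚ C u
      C-℘ u = C-+ (u ^ p) (- u) (constant-^-homo u p) P.refl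

      C-≈0 : ∀ {u f} → u ≈ 0# → C u ≋ f → f ≋ []
      C-≈0 u≈0 u≋f = P.trans (P.sym u≋f) (P.trans (constant-cong u≈0) constant-0)

      C-fixed : ∀ {k} → k ^ p ≈ k → C k ^ₚ p ≋ C k
      C-fixed {k} kᵖ≈k = P.trans (P.sym (constant-^-homo k p)) (constant-cong kᵖ≈k)

      reducible-odd : ∀ {m} → p ≡ suc (m ℕ.+ m) → 3 ≤ p → ∀ g → HasDegree g 1 →
                      QuadraticParameters b⁻¹ e → Reducible (f ∘ₚ (f ∘ₚ g))
      reducible-odd {m} p≡1+2m 3≤p g g-deg (k , u , w , kᵖ≈k , linear≈0 , constant≈0) = conclude (v-degree
        (HasDegree-+-multiple x y x-deg y-deg (≡.subst (1 <_) (≡.sym (ℕ.*-identityʳ p)) (prime≥2 p-prime)) u))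
        where
        N = p ℕ.* 1
        x = scale g
        y = scale (f ∘ₚ g)
        P₂ = f ∘ₚ (f ∘ₚ g)
        v = x +ₚ C u *ₚ y +ₚ C k *ₚ (y *ₚ y) +ₚ C w
        y-deg′ : HasDegree (f ∘ₚ g) N
        y-deg′ = f∘-degree g g-deg ℕ.≤-refl
        x-deg : HasDegree x 1
        x-deg = scale-degree g g-deg
        y-deg : HasDegree y N
        y-deg = scale-degree (f ∘ₚ g) y-deg′
        0<N : 0 < N
        0<N = ≡.subst (0 <_) (≡.sym (ℕ.*-identityʳ p)) (ℕ.<⇒≤ (prime≥2 p-prime))
        P₂-deg : HasDegree P₂ (p ℕ.* N)
        P₂-deg = f∘-degree (f ∘ₚ g) y-deg′ 0<N
        invariant : P₂ ∣ v ^ₚ p -ₚ v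
        invariant = ∣-scale P₂ (quadratic {x} {y} {C b⁻¹} {C e} {C k} {C u} {C w} {C b⁻¹ *ₚ scale P₂}
          (scale^p g) (scale^p (f ∘ₚ g)) (C-fixed kᵖ≈k)
          (C-≈0 linear≈0 (C-+ (b⁻¹ + (k + k) * e) (℘ u) (C-+ b⁻¹ ((k + k) * e) P.refl (C-* (k + k) e P.refl P.refl)) (C-℘ u)))
          (C-≈0 constant≈0 (C-+ (e + k * (e * e) + u ^ p * e) (℘ w)
            (C-+ (e + k * (e * e)) (u ^ p * e) (C-+ e (k * (e * e)) P.refl (C-* k (e * e) P.refl (C-* e e P.refl P.refl)))
              (C-* (u ^ p) e (constant-^-homo u p) P.refl)) (C-℘ w))))
        1ₚ = constant 1#
        factor : v ^ₚ p -ₚ v ≋ v *ₚ ((v ^ₚ m -ₚ 1ₚ) *ₚ ((v ^ₚ m +ₚ 1ₚ) *ₚ 1ₚ))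
        factor = begin
          v ^ₚ p -ₚ v
            -- `v` is padded to `v (1ₚ 1ₚ)`, because the solver step treats `1ₚ` as a variable `o`.
            ≈⟨ P.+-cong (P.trans (^ₚ-congʳ v p≡1+2m) (P.*-congˡ {v} (^ₚ-homo-* v m m)))
                 (P.-‿cong (P.sym (P.trans (P.*-congˡ {v} (P.*-identityˡ 1ₚ)) (P.*-identityʳ v)))) ⟩
          v *ₚ (v ^ₚ m *ₚ v ^ₚ m) -ₚ v *ₚ (1ₚ *ₚ 1ₚ)
            ≈⟨ solve 3 (λ v vᵐ o →
                 v :* (vᵐ :* vᵐ) :- v :* (o :* o)
                 := v :* ((vᵐ :- o) :* (vᵐ :+ o)))
                 P.refl v (v ^ₚ m) 1ₚ ⟩
          v *ₚ ((v ^ₚ m -ₚ 1ₚ) *ₚ (v ^ₚ m +ₚ 1ₚ))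
            ≈⟨ P.*-congˡ {v} (P.*-congˡ {v ^ₚ m -ₚ 1ₚ} (P.*-identityʳ (v ^ₚ m +ₚ 1ₚ))) ⟨
          v *ₚ ((v ^ₚ m -ₚ 1ₚ) *ₚ ((v ^ₚ m +ₚ 1ₚ) *ₚ 1ₚ)) ∎
        1≤m : ∀ m → 3 ≤ suc (m ℕ.+ m) → 1 ≤ m
        1≤m zero    (s≤s ())
        1≤m (suc m) _ = s≤s z≤n
        conclude : ∃[ n ] (1 ≤ n ∧ n ≤ N ℕ.+ N ∧ HasDegree v n) → Reducible P₂
        conclude (n , 1≤n , n≤2N , v-deg) =
          reducible-if-∣-product (v ∷ (v ^ₚ m -ₚ 1ₚ) ∷ (v ^ₚ m +ₚ 1ₚ) ∷ [])
            P₂-deg (ℕ.≤-trans 0<N (ℕ.m≤n*m N p {{ℕ.>-nonZero (ℕ.<⇒≤ (prime≥2 p-prime))}}))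
            ((n , ℕ.≤-<-trans n≤2N 2N<pN , v-deg) ∷
             (m ℕ.* n , mn<pN , HasDegree-shift (v ^ₚ m) (- 1#) vᵐ-deg 0<mn) ∷
             (m ℕ.* n , mn<pN , HasDegree-shift (v ^ₚ m) 1# vᵐ-deg 0<mn) ∷ [])
            (∣ʳ-respʳ-≈ factor invariant)
          where
          instance _ = ℕ.>-nonZero 0<N
          2N<pN : N ℕ.+ N < p ℕ.* N
          2N<pN = ≡.subst (_< p ℕ.* N) (≡.cong (N ℕ.+_) (ℕ.+-identityʳ N)) (ℕ.*-monoˡ-< N 3≤p)
          -- `m n ≤ 2 m N < (2 m + 1) N`.
          mn<pN : m ℕ.* n < p ℕ.* N
          mn<pN = ℕ.≤-<-trans (ℕ.*-monoʳ-≤ m n≤2N) (≡.subst₂ _<_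
            (≡.trans (ℕ.*-distribʳ-+ N m m) (≡.sym (ℕ.*-distribˡ-+ m N N)))
            (≡.cong (ℕ._* N) (≡.sym p≡1+2m))
            (ℕ.*-monoˡ-< N (ℕ.n<1+n (m ℕ.+ m))))
          vᵐ-deg : HasDegree (v ^ₚ m) (m ℕ.* n)
          vᵐ-deg = HasDegree-^ v m v-deg
          0<mn : 0 < m ℕ.* n
          0<mn = ℕ.*-mono-≤ (1≤m m (≡.subst (3 ≤_) p≡1+2m 3≤p)) 1≤n
        -- The degrees `1 < N < 2 N` of `x`, `y` and `y²` differ, so nothing cancels at the top
        -- whatever `u` and `k` are, and the coefficient 1 of `x` keeps the degree positive.
        v-degree : ∃[ n ] (1 ≤ n ∧ n ≤ N ∧ HasDegree (x +ₚ C u *ₚ y) n) → ∃[ n ] (1 ≤ n ∧ n ≤ N ℕ.+ N ∧ HasDegree v n)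
        v-degree (n , 1≤n , n≤N , deg) =
          let n′ , n≤n′ , n′≤2N , deg′ = HasDegree-+-multiple (x +ₚ C u *ₚ y) (y *ₚ y) deg (HasDegree-* y y y-deg y-deg)
                (ℕ.≤-<-trans n≤N (ℕ.m<m+n N 0<N)) k
          in n′ , ℕ.≤-trans 1≤n n≤n′ , n′≤2N , HasDegree-shift (x +ₚ C u *ₚ y +ₚ C k *ₚ (y *ₚ y)) w deg′ (ℕ.≤-trans 1≤n n≤n′)

      reducible-even : p ≡ 2 → ∀ g → HasDegree g 1 → LinearParameters b⁻¹ e ⊎ BilinearParameters b⁻¹ e →
                       Reducible (f ∘ₚ (f ∘ₚ (f ∘ₚ g)))
      reducible-even p≡2 g g-deg = λ where
          -- The pair is `y`, `z` rather than `x`, `y`: modulo the third iterate it is `zᵖ` that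
          -- closes up to `z + e`.
          (inj₁ (u , w , linear≈0 , constant≈0)) → conclude (y +ₚ C u *ₚ z +ₚ C w)
            (let n , Y≤n , n≤Z , deg = HasDegree-+-multiple y z y-deg z-deg Y<Z u
                 1≤n = ℕ.≤-trans (ℕ.<⇒≤ 1<Y) Y≤n
             in n , 1≤n , ℕ.≤-trans n≤Z (ℕ.m≤n+m Z Y) , HasDegree-shift (y +ₚ C u *ₚ z) w deg 1≤n)
            (∣-scale P₃ (linear {y} {z} {C b⁻¹} {C e} {C u} {C w} {C b⁻¹ *ₚ scale P₃}
              (scale^p (f ∘ₚ g)) (scale^p (f ∘ₚ (f ∘ₚ g)))
              (C-≈0 linear≈0 (C-+ b⁻¹ (℘ u) P.refl (C-℘ u)))
              (C-≈0 constant≈0 (C-+ (e + u ^ p * e) (℘ w)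
                (C-+ e (u ^ p * e) P.refl (C-* (u ^ p) e (constant-^-homo u p) P.refl)) (C-℘ w)))))
          (inj₂ (k , t , u , w , kᵖ≈k , linear-y≈0 , linear-z≈0 , constant≈0)) → conclude
            (x +ₚ C t *ₚ y +ₚ C u *ₚ z +ₚ C k *ₚ (y *ₚ z) +ₚ C w)
            (let n₁ , 1≤n₁ , n₁≤Y , deg₁ = HasDegree-+-multiple x y x-deg y-deg 1<Y t
                 n₂ , n₁≤n₂ , n₂≤Z , deg₂ = HasDegree-+-multiple (x +ₚ C t *ₚ y) z deg₁ z-deg (ℕ.≤-<-trans n₁≤Y Y<Z) u
                 n₃ , n₂≤n₃ , n₃≤Y+Z , deg₃ = HasDegree-+-multiple (x +ₚ C t *ₚ y +ₚ C u *ₚ z) (y *ₚ z) deg₂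
                   (HasDegree-* y z y-deg z-deg) (ℕ.≤-<-trans n₂≤Z (ℕ.m<n+m Z (ℕ.<⇒≤ 1<Y))) k
                 1≤n₃ = ℕ.≤-trans 1≤n₁ (ℕ.≤-trans n₁≤n₂ n₂≤n₃)
             in n₃ , 1≤n₃ , n₃≤Y+Z , HasDegree-shift (x +ₚ C t *ₚ y +ₚ C u *ₚ z +ₚ C k *ₚ (y *ₚ z)) w deg₃ 1≤n₃)
            (∣-scale P₃ (bilinear {x} {y} {z} {C b⁻¹} {C e} {C k} {C t} {C u} {C w} {C b⁻¹ *ₚ scale P₃}
              (P.trans (^ₚ-congʳ z p≡2) (P.*-congˡ {z} (P.*-identityʳ z)))
              (scale^p g) (scale^p (f ∘ₚ g)) (scale^p (f ∘ₚ (f ∘ₚ g))) (C-fixed kᵖ≈k)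
              (C-≈0 linear-y≈0 (C-+ (b⁻¹ + k * e) (℘ t) (C-+ b⁻¹ (k * e) P.refl (C-* k e P.refl P.refl)) (C-℘ t)))
              (C-≈0 linear-z≈0 (C-+ (k * (b⁻¹ + e + b⁻¹ * e) + t ^ p * b⁻¹) (℘ u)
                (C-+ (k * (b⁻¹ + e + b⁻¹ * e)) (t ^ p * b⁻¹)
                  (C-* k (b⁻¹ + e + b⁻¹ * e) P.refl (C-+ (b⁻¹ + e) (b⁻¹ * e) P.refl (C-* b⁻¹ e P.refl P.refl)))
                  (C-* (t ^ p) b⁻¹ (constant-^-homo t p) P.refl)) (C-℘ u)))
              (C-≈0 constant≈0 (C-+ (e + k * (b⁻¹ * e + e * e) + t ^ p * e + u ^ p * e) (℘ w)
                (C-+ (e + k * (b⁻¹ * e + e * e) + t ^ p * e) (u ^ p * e)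
                  (C-+ (e + k * (b⁻¹ * e + e * e)) (t ^ p * e)
                    (C-+ e (k * (b⁻¹ * e + e * e)) P.refl (C-* k (b⁻¹ * e + e * e) P.refl
                      (C-+ (b⁻¹ * e) (e * e) (C-* b⁻¹ e P.refl P.refl) (C-* e e P.refl P.refl))))
                    (C-* (t ^ p) e (constant-^-homo t p) P.refl))
                  (C-* (u ^ p) e (constant-^-homo u p) P.refl)) (C-℘ w)))))
        where
        Y = p ℕ.* 1
        Z = p ℕ.* Y
        x = scale g
        y = scale (f ∘ₚ g)
        z = scale (f ∘ₚ (f ∘ₚ g))
        P₃ = f ∘ₚ (f ∘ₚ (f ∘ₚ g))
        1<Y : 1 < Y
        1<Y = ≡.subst (1 <_) (≡.sym (ℕ.*-identityʳ p)) (prime≥2 p-prime)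
        Y<Z : Y < Z
        Y<Z = ≡.subst (Y <_) (ℕ.*-comm Y p) (ℕ.m<m*n Y p {{ℕ.>-nonZero (ℕ.<⇒≤ 1<Y)}} (prime≥2 p-prime))
        y-deg′ : HasDegree (f ∘ₚ g) Y
        y-deg′ = f∘-degree g g-deg ℕ.≤-refl
        z-deg′ : HasDegree (f ∘ₚ (f ∘ₚ g)) Z
        z-deg′ = f∘-degree (f ∘ₚ g) y-deg′ (ℕ.<⇒≤ 1<Y)
        x-deg : HasDegree x 1
        x-deg = scale-degree g g-deg
        y-deg : HasDegree y Y
        y-deg = scale-degree (f ∘ₚ g) y-deg′
        z-deg : HasDegree z Z
        z-deg = scale-degree (f ∘ₚ (f ∘ₚ g)) z-deg′
        1ₚ = constant 1#
        conclude : ∀ v → ∃[ n ] (1 ≤ n ∧ n ≤ Y ℕ.+ Z ∧ HasDegree v n) → P₃ ∣ v ^ₚ p -ₚ v → Reducible P₃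
        conclude v (n , 1≤n , n≤Y+Z , v-deg) P₃∣ = reducible-if-∣-product (v ∷ (v -ₚ 1ₚ) ∷ [])
          (f∘-degree (f ∘ₚ (f ∘ₚ g)) z-deg′ (ℕ.≤-trans (ℕ.<⇒≤ 1<Y) (ℕ.<⇒≤ Y<Z)))
          (ℕ.≤-<-trans z≤n n<pZ)
          ((n , n<pZ , v-deg) ∷ (n , n<pZ , HasDegree-shift v (- 1#) v-deg 1≤n) ∷ [])
          (∣ʳ-respʳ-≈ factor P₃∣)
          where
          n<pZ : n < p ℕ.* Z
          n<pZ = ℕ.≤-<-trans n≤Y+Z (2+4<8 p≡2)
          factor : v ^ₚ p -ₚ v ≋ v *ₚ ((v -ₚ 1ₚ) *ₚ 1ₚ)
          factor = begin
            v ^ₚ p -ₚ v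
              ≈⟨ P.+-cong (^ₚ-congʳ v p≡2)
                   (P.-‿cong (P.sym (P.trans (P.*-congˡ {v} (P.*-identityˡ 1ₚ)) (P.*-identityʳ v)))) ⟩
            v *ₚ (v *ₚ 1ₚ) -ₚ v *ₚ (1ₚ *ₚ 1ₚ)
              ≈⟨ solve 2 (λ v o → v :* (v :* o) :- v :* (o :* o) := v :* ((v :- o) :* o)) P.refl v 1ₚ ⟩
            v *ₚ ((v -ₚ 1ₚ) *ₚ 1ₚ) ∎

    second-iterate-reducible : 3 ≤ p → Reducible (f ^∘ 2)
    second-iterate-reducible 3≤p = by-cases (root-or-kernel a b c)
      where
      by-cases : Root a b c ⊎ (¬ Root a b c ∧ KernelElement a b) → Reducible (f ^∘ 2)
      by-cases (inj₁ (r , root)) = reducible-if-root root (f ∘ₚ X) (f∘-degree X HasDegree-X ℕ.≤-refl) (1≤p* ℕ.≤-refl)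
      by-cases (inj₂ (¬root , d , d≉0 , adᵖ≈bd)) =
        let b⁻¹ , b⁻¹b≈1 = inverse b b≉0
            d⁻¹ , d⁻¹d≈1 = inverse d d≉0
            m , p≡1+2m = odd-prime p-prime 3≤p
            open NoRoot b⁻¹b≈1 d⁻¹d≈1 adᵖ≈bd ¬root
        in reducible-odd {m} p≡1+2m 3≤p X HasDegree-X (parameters-odd e∉℘ {m} p≡1+2m b⁻¹)

    third-iterate-reducible : p ≡ 2 → Reducible (f ^∘ 3)
    third-iterate-reducible p≡2 = by-cases (root-or-kernel a b c)
      where
      by-cases : Root a b c ⊎ (¬ Root a b c ∧ KernelElement a b) → Reducible (f ^∘ 3)
      by-cases (inj₁ (r , root)) = reducible-if-root root (f ∘ₚ (f ∘ₚ X))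
        (f∘-degree (f ∘ₚ X) (f∘-degree X HasDegree-X ℕ.≤-refl) (1≤p* ℕ.≤-refl)) (1≤p* (1≤p* ℕ.≤-refl))
      by-cases (inj₂ (¬root , d , d≉0 , adᵖ≈bd)) =
        let b⁻¹ , b⁻¹b≈1 = inverse b b≉0
            d⁻¹ , d⁻¹d≈1 = inverse d d≉0
            open NoRoot b⁻¹b≈1 d⁻¹d≈1 adᵖ≈bd ¬root
        in reducible-even p≡2 X HasDegree-X (parameters-even e∉℘ b⁻¹)

open import Data.Nat.Base using (_^_)
open import Data.Product.Base using (_×_)

theorem29 : ∀ {c ℓ₁ ℓ₂ : Level} (p s : ℕ) → Prime p → 1 ≤ s →
    (F : FiniteField c ℓ₁ ℓ₂ (p ^ s)) →
    let open FiniteField F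
        open Polynomials commutativeRing
    in (aₚ a₁ a₀ : Carrier) → ¬ (aₚ * a₁ ≈ 0#) →
       let f = monomial aₚ p -ₚ monomial a₁ 1 -ₚ constant a₀
       in (3 ≤ p → Reducible (f ^∘ 2)) × (p ≡ 2 → Reducible (f ^∘ 3))
theorem29 p s p-prime _ F aₚ a₁ a₀ aₚa₁≉0 =
  second-iterate-reducible aₚ≉0 a₁≉0 a₀ , third-iterate-reducible aₚ≉0 a₁≉0 a₀
  where
  open Iteration {s = s} p-prime F
  open FiniteField F using (commutativeRing)
  open CommutativeRing commutativeRing
  aₚ≉0 : ¬ (aₚ ≈ 0#)
  aₚ≉0 aₚ≈0 = aₚa₁≉0 (trans (*-congʳ aₚ≈0) (zeroˡ a₁))
  a₁≉0 : ¬ (a₁ ≈ 0#)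
  a₁≉0 a₁≈0 = aₚa₁≉0 (trans (*-congˡ a₁≈0) (zeroʳ aₚ))
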